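{- Let $k\in\mathbb{N}_0$ and $n\in\mathbb{N}$. Then \[ n\, r_k(n) = 2k \left( \sigma^{\ast}(n)- 4 \sigma^{\ast}(n/2) + \sum_{j=1}^{n-1} r_k (j) \left( \sigma^{\ast}(n-j)- 4 \sigma^{\ast}\!\left(\tfrac{n-j}{2}\right) \right) \right). \]
   Context: For $k\in\mathbb{N}_0$ and $n\in\mathbb{N}_0$, $r_k(n)=\#\{(x_1,\dots,x_k)\in\mathbb{Z}^k : n=x_1^2+\dots+x_k^2\}$. The function $\sigma^{\ast}$ is defined on $\mathbb{Q}$ by $\sigma^{\ast}(q)=0$ if $q\notin\mathbb{N}=\{1,2,3,\dots\}$, and for $q\in\mathbb{N}$, $\sigma^{\ast}(q)=\sum_{d\mid q,\ q/d\text{ odd}} d$. -}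

module Defs where

open import Data.Nat as ℕ using (ℕ; zero; suc; _≡ᵇ_)
open import Data.Nat.DivMod using (_/_; _%_)
open import Data.Integer as ℤ using (ℤ; +_; -_)
open import Data.List using (List; []; _∷_; map; concatMap; filter; length; upTo; applyUpTo)
open import Data.Nat.ListAction using (sum)
open import Data.Bool using (Bool; true; false; if_then_else_)
open import Relation.Nullary.Decidable using (⌊_⌋)
open import Data.Integer.Properties using () renaming (_≟_ to _≟ℤ_)

intsUpTo : ℕ → List ℤ
intsUpTo n = map (λ i → +_ i ℤ.- + n) (upTo (n ℕ.+ n ℕ.+ 1))

tuples : ℕ → List ℤ → List (List ℤ)
tuples zero xs = [] ∷ []
tuples (suc k) xs = concatMap (λ x → map (x ∷_) (tuples k xs)) xs

sumSq : List ℤ → ℤ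
sumSq [] = + 0
sumSq (x ∷ xs) = x ℤ.* x ℤ.+ sumSq xs

-- r k n = #{ x ∈ ℤ^k : n = x₁² + … + x_k² }.
-- Every solution has |xᵢ| ≤ n, so enumerating the box [-n,n]^k counts
-- exactly the full solution set.
r : ℕ → ℕ → ℕ
r k n = length (filter (λ xs → sumSq xs ≟ℤ + n) (tuples k (intsUpTo n)))

-- σ* on ℕ ⊂ ℚ: σ*(0) = 0 (0 ∉ ℕ), σ*(q) = Σ_{d ∣ q, q/d odd} d
sigmaStar : ℕ → ℕ
sigmaStar zero = 0
sigmaStar q@(suc _) =
  sum (map (λ d → if ((q % suc d) ≡ᵇ 0) ∧' (((q / suc d) % 2) ≡ᵇ 1) then suc d else 0) (upTo q))
  where
  _∧'_ : Bool → Bool → Bool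
  true ∧' b = b
  false ∧' _ = false

-- σ*(m/2) for m ∈ ℕ: the rational m/2 lies in ℕ = {1,2,...} iff m is even and m > 0
sigmaStarHalf : ℕ → ℕ
sigmaStarHalf m = if (m % 2) ≡ᵇ 0 then sigmaStar (m / 2) else 0

sumRange : ℕ → (ℕ → ℤ) → ℤ
sumRange n f = Data.List.foldr ℤ._+_ (+ 0) (map f (applyUpTo suc (n ℕ.∸ 1)))

{-# OPTIONS --safe #-}

-- Summing x₁² + … + x_k² over the solutions of n = x₁² + … + x_k² coordinate by coordinate
-- reduces the recurrence to k = 1, that is, to Σ_x G (m - x²) = m [m is a square] with
-- G m = σ*(m) - 4 σ*(m/2) = -(-1)ᵐ σ*(m), half the mth coefficient of q θ′ / θ for the theta series θ = Σ_x q^(x²).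
-- Up to sign the left side is the sum of (-1)ˣ d over m = x² + d e with d, e > 0 and e odd, where d may be
-- replaced by x + d since x ↦ -x kills the sum of (-1)ˣ x. With s = x + d and f = e - d - 2 x the equation
-- reads m = s² + d f, and sign-reversing involutions (exchanging d and ±f, or negating s) cancel every
-- term with f ≠ 0. The terms with f = 0 exist only for m = s², and there are s of them, all equal to ±s.
module Submission where

open import Defs
open import Data.Nat using (ℕ; suc; _∸_)
open import Data.Integer using (ℤ; +_; _+_; _-_; _*_)
open import Relation.Binary.PropositionalEquality
  using (_≡_; refl; sym; trans; cong; cong₂; subst; subst₂; module ≡-Reasoning)

open import Data.Bool using (true; false; if_then_else_)
open import Data.Empty using (⊥-elim)
open import Data.Integer using (-[1+_]; 0ℤ; 1ℤ; -1ℤ; -_; _≤_; _<_; ∣_∣; _⊖_; _^_; +≤+; +<+)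
import Data.Integer.Properties as ℤ
open import Algebra.Properties.AbelianGroup ℤ.+-0-abelianGroup using (∙-cancelʳ)
open import Data.Integer.Tactic.RingSolver using (solve; solve-∀)
open import Data.List
  using (List; []; _∷_; _++_; map; concatMap; filter; length; foldr; upTo; cartesianProduct)
open import Data.List.Membership.Propositional using (_∈_)
open import Data.List.Membership.Propositional.Properties
  using (∈-map⁺; ∈-upTo⁺; ∈-upTo⁻; ∈-cartesianProduct⁺)
open import Data.List.Properties using (length-upTo)
import Data.List.Relation.Unary.All as All
open import Data.List.Relation.Unary.AllPairs using (_∷_)
open import Data.List.Relation.Unary.Any using (here; there)
open import Data.List.Relation.Unary.Unique.Propositional using (Unique)
import Data.List.Relation.Unary.Unique.Propositional.Properties as Unique
open import Data.Nat as ℕ using (zero; z≤n; s≤s; _≡ᵇ_; ⌊_/2⌋)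
open import Data.Nat.DivMod using (_/_; _%_; m≡m%n+[m/n]*n; m%n<n; m*n/n≡m; m*n%n≡0; m/n≤m)
open import Data.Nat.ListAction using (sum)
import Data.Nat.Properties as ℕ
open import Data.Product using (Σ; _×_; _,_; proj₁; proj₂)
open import Data.Product.Properties using (≡-dec)
open import Data.Sum using (_⊎_; inj₁; inj₂)
open import Data.Unit using (⊤; tt)
open import Function using (_∘_; id)
open import Relation.Binary.Definitions using (DecidableEquality; tri<; tri≈; tri>)
open import Relation.Nullary using (Dec; yes; no; does; ¬_)
open import Relation.Nullary.Decidable using (_×-dec_)

-- In terms of s and f one has e = f - d + 2 s, so e is odd exactly when d and f have opposite
-- parity, and the sign is (-1)^(s - d). Hence exchanging d with f or -f keeps s and flips the sign.
-- The obstacle is that the image must again have e > 0. For f < 0, exchanging d with -f leaves e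
-- unchanged. For f > 0 the exchange produces d - f + 2 s, which may be negative, whereas negating s
-- produces f - d - 2 s, the opposite number. So exactly one of the two moves is admissible, except
-- when d - f + 2 s = 0; that would mean e = 4 s, impossible for odd e.

private variable
  A B P Q : Set

-- Guarded finite sums

-- Conditions sit in the summand and not in the index list, so a sum over a solution set is a sum
-- over a fixed box and can be swapped, split and scaled without touching the list.
guard : Dec P → ℤ → ℤ
guard p v = if does p then v else 0ℤ

guard-yes : (p : Dec P) → P → ∀ v → guard p v ≡ v
guard-yes (yes _) _ v = refl
guard-yes (no ¬p) p v = ⊥-elim (¬p p)

guard-no : (p : Dec P) → ¬ P → ∀ v → guard p v ≡ 0ℤ
guard-no (yes p) ¬p v = ⊥-elim (¬p p)
guard-no (no _)  ¬p v = refl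

guard-zero : (p : Dec P) → guard p 0ℤ ≡ 0ℤ
guard-zero (yes _) = refl
guard-zero (no _)  = refl

guard-cong : (p : Dec P) (q : Dec Q) {v w : ℤ} → (P → Q) → (Q → P) → (P → v ≡ w) → guard p v ≡ guard q w
guard-cong (yes p) q f g h = trans (h p) (sym (guard-yes q (f p) _))
guard-cong (no ¬p) q f g h = sym (guard-no q (¬p ∘ g) _)

guard-× : (p : Dec P) (q : Dec Q) (v : ℤ) → guard p (guard q v) ≡ guard (p ×-dec q) v
guard-× (yes _) (yes _) v = refl
guard-× (yes _) (no _)  v = refl
guard-× (no _)  q       v = refl

guard-* : (p : Dec P) (c v : ℤ) → guard p (c * v) ≡ c * guard p v
guard-* (yes _) c v = refl
guard-* (no _)  c v = sym (ℤ.*-zeroʳ c)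

guard-scale : (p : Dec P) (v : ℤ) → guard p v ≡ v * guard p 1ℤ
guard-scale p v = trans (cong (guard p) (sym (ℤ.*-identityʳ v))) (guard-* p v 1ℤ)

guard-+ : (p : Dec P) (v w : ℤ) → guard p (v + w) ≡ guard p v + guard p w
guard-+ (yes _) v w = refl
guard-+ (no _)  v w = refl

∑ : List A → (A → ℤ) → ℤ
∑ xs f = foldr _+_ 0ℤ (map f xs)

∑-cong-∈ : (xs : List A) {f g : A → ℤ} → (∀ {a} → a ∈ xs → f a ≡ g a) → ∑ xs f ≡ ∑ xs g
∑-cong-∈ []       h = refl
∑-cong-∈ (x ∷ xs) h = cong₂ _+_ (h (here refl)) (∑-cong-∈ xs (h ∘ there))

∑-cong : (xs : List A) {f g : A → ℤ} → (∀ a → f a ≡ g a) → ∑ xs f ≡ ∑ xs g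
∑-cong xs h = ∑-cong-∈ xs (λ {a} _ → h a)

∑-const : (xs : List A) (c : ℤ) → ∑ xs (λ _ → c) ≡ + length xs * c
∑-const []       c = refl
∑-const (x ∷ xs) c = trans (cong (_+_ c) (∑-const xs c)) (sym (ℤ.suc-* (+ length xs) c))

∑-zero : (xs : List A) {f : A → ℤ} → (∀ {a} → a ∈ xs → f a ≡ 0ℤ) → ∑ xs f ≡ 0ℤ
∑-zero xs h = trans (∑-cong-∈ xs h) (trans (∑-const xs 0ℤ) (ℤ.*-zeroʳ (+ length xs)))

∑-+ : (xs : List A) (f g : A → ℤ) → ∑ xs (λ a → f a + g a) ≡ ∑ xs f + ∑ xs g
∑-+ []       f g = refl
∑-+ (x ∷ xs) f g = trans (cong (_+_ (f x + g x)) (∑-+ xs f g)) (interchange (f x) (g x) (∑ xs f) (∑ xs g))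
  where
  interchange : ∀ a b c d → a + b + (c + d) ≡ a + c + (b + d)
  interchange = solve-∀

∑-* : (xs : List A) (c : ℤ) (f : A → ℤ) → ∑ xs (λ a → c * f a) ≡ c * ∑ xs f
∑-* []       c f = sym (ℤ.*-zeroʳ c)
∑-* (x ∷ xs) c f = trans (cong (_+_ (c * f x)) (∑-* xs c f)) (sym (ℤ.*-distribˡ-+ c (f x) (∑ xs f)))

∑-swap : (xs : List A) (ys : List B) (f : A → B → ℤ) →
         ∑ xs (λ a → ∑ ys (f a)) ≡ ∑ ys (λ b → ∑ xs (λ a → f a b))
∑-swap []       ys f = sym (∑-zero ys λ _ → refl)
∑-swap (x ∷ xs) ys f = trans (cong (_+_ (∑ ys (f x))) (∑-swap xs ys f)) (sym (∑-+ ys (f x) _))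

∑-++ : (xs ys : List A) (f : A → ℤ) → ∑ (xs ++ ys) f ≡ ∑ xs f + ∑ ys f
∑-++ []       ys f = sym (ℤ.+-identityˡ _)
∑-++ (x ∷ xs) ys f = trans (cong (_+_ (f x)) (∑-++ xs ys f)) (sym (ℤ.+-assoc (f x) _ _))

∑-map : (h : A → B) (xs : List A) (f : B → ℤ) → ∑ (map h xs) f ≡ ∑ xs (f ∘ h)
∑-map h []       f = refl
∑-map h (x ∷ xs) f = cong (_+_ (f (h x))) (∑-map h xs f)

∑-concatMap : (h : A → List B) (xs : List A) (f : B → ℤ) → ∑ (concatMap h xs) f ≡ ∑ xs (λ a → ∑ (h a) f)
∑-concatMap h []       f = refl
∑-concatMap h (x ∷ xs) f = trans (∑-++ (h x) (concatMap h xs) f) (cong (_+_ (∑ (h x) f)) (∑-concatMap h xs f))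

∑-cartesianProduct : (xs : List A) (ys : List B) (f : A × B → ℤ) →
                     ∑ (cartesianProduct xs ys) f ≡ ∑ xs (λ a → ∑ ys (λ b → f (a , b)))
∑-cartesianProduct []       ys f = refl
∑-cartesianProduct (x ∷ xs) ys f =
  trans (∑-++ (map (x ,_) ys) _ f) (cong₂ _+_ (∑-map (x ,_) ys f) (∑-cartesianProduct xs ys f))

∑-filter : {P : A → Set} (P? : ∀ a → Dec (P a)) (xs : List A) →
           + length (filter P? xs) ≡ ∑ xs (λ a → guard (P? a) 1ℤ)
∑-filter P? [] = refl
∑-filter P? (x ∷ xs) with P? x
... | yes _ = cong (_+_ 1ℤ) (∑-filter P? xs)
... | no _  = trans (∑-filter P? xs) (sym (ℤ.+-identityˡ _))

-- The list may hold further elements, which the guard discards. Thus one box serves many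
-- predicates, and boxes of different sizes can be compared.
_Enumerates_ : List A → (A → Set) → Set
xs Enumerates P = Unique xs × (∀ {a} → P a → a ∈ xs)

∑-pick : (_≟_ : DecidableEquality A) {xs : List A} {b : A} (v : ℤ) → Unique xs → b ∈ xs →
         ∑ xs (λ a → guard (a ≟ b) v) ≡ v
∑-pick _≟_ {x ∷ xs} v (x∉ ∷ _) (here refl) =
  trans (cong₂ _+_ (guard-yes (x ≟ x) refl v)
                   (∑-zero xs λ a∈ → guard-no (_ ≟ x) (λ { refl → All.lookup x∉ a∈ refl }) v))
        (ℤ.+-identityʳ v)
∑-pick _≟_ {x ∷ xs} v (x∉ ∷ u) (there b∈) =
  trans (cong₂ _+_ (guard-no (x ≟ _) (All.lookup x∉ b∈) v) (∑-pick _≟_ v u b∈)) (ℤ.+-identityˡ v)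

module _ (_≟A_ : DecidableEquality A) (_≟B_ : DecidableEquality B)
         {P : A → Set} (P? : ∀ a → Dec (P a)) {Q : B → Set} (Q? : ∀ b → Dec (Q b)) where

  -- Both sides are the double sum of f over the graph of φ, taken in the two orders.
  ∑-bijection : {xs : List A} {ys : List B} → xs Enumerates P → ys Enumerates Q →
                {f : A → ℤ} {g : B → ℤ} (φ : A → B) (ψ : B → A) →
                (∀ {a} → P a → Q (φ a)) → (∀ {a} → P a → ψ (φ a) ≡ a) →
                (∀ {b} → Q b → P (ψ b)) → (∀ {b} → Q b → φ (ψ b) ≡ b) →
                (∀ {a} → P a → f a ≡ g (φ a)) →
                ∑ xs (λ a → guard (P? a) (f a)) ≡ ∑ ys (λ b → guard (Q? b) (g b))
  ∑-bijection {xs} {ys} (uxs , xs∋) (uys , ys∋) {f} {g} φ ψ PQ ψφ QP φψ fg = begin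
    ∑ xs (λ a → guard (P? a) (f a))
      ≡⟨ ∑-cong xs (λ a → spread _≟B_ uys (P? a) (ys∋ ∘ PQ)) ⟩
    ∑ xs (λ a → ∑ ys (λ b → guard (P? a) (guard (b ≟B φ a) (f a))))
      ≡⟨ ∑-swap xs ys _ ⟩
    ∑ ys (λ b → ∑ xs (λ a → guard (P? a) (guard (b ≟B φ a) (f a))))
      ≡⟨ ∑-cong ys (λ b → ∑-cong xs (λ a → graph a b)) ⟩
    ∑ ys (λ b → ∑ xs (λ a → guard (Q? b) (guard (a ≟A ψ b) (g b))))
      ≡⟨ ∑-cong ys (λ b → spread _≟A_ uxs (Q? b) (xs∋ ∘ QP)) ⟨
    ∑ ys (λ b → guard (Q? b) (g b)) ∎
    where
    open ≡-Reasoning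
    spread : {C R : Set} (_≟_ : DecidableEquality C) {zs : List C} {c : C} {v : ℤ} → Unique zs →
             (r : Dec R) → (R → c ∈ zs) → guard r v ≡ ∑ zs (λ z → guard r (guard (z ≟ c) v))
    spread _≟_ u (yes r) c∈ = sym (∑-pick _≟_ _ u (c∈ r))
    spread _≟_ {zs} u (no _)  c∈ = sym (∑-zero zs λ _ → refl)
    graph : ∀ a b → guard (P? a) (guard (b ≟B φ a) (f a)) ≡ guard (Q? b) (guard (a ≟A ψ b) (g b))
    graph a b = begin
      guard (P? a) (guard (b ≟B φ a) (f a))  ≡⟨ guard-× (P? a) (b ≟B φ a) _ ⟩
      guard (P? a ×-dec (b ≟B φ a)) (f a)
        ≡⟨ guard-cong (P? a ×-dec (b ≟B φ a)) (Q? b ×-dec (a ≟A ψ b))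
             (λ { (p , refl) → PQ p , sym (ψφ p) }) (λ { (q , refl) → QP q , sym (φψ q) })
             (λ { (p , refl) → fg p }) ⟩
      guard (Q? b ×-dec (a ≟A ψ b)) (g b)    ≡⟨ guard-× (Q? b) (a ≟A ψ b) _ ⟨
      guard (Q? b) (guard (a ≟A ψ b) (g b))  ∎

i≡-i⇒i≡0 : ∀ {i} → i ≡ - i → i ≡ 0ℤ
i≡-i⇒i≡0 {+ zero} _ = refl

module _ (_≟A_ : DecidableEquality A) {P : A → Set} (P? : ∀ a → Dec (P a))
         {xs : List A} (enum : xs Enumerates P) where

  -- Reindexing along `φ` turns the sum into its own negative. At a fixed point of `φ` the value is
  -- its own negative, hence zero.
  ∑-involution : {f : A → ℤ} (φ : A → A) →
                 (∀ {a} → P a → P (φ a)) → (∀ {a} → P a → φ (φ a) ≡ a) →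
                 (∀ {a} → P a → f (φ a) ≡ - f a) → ∑ xs (λ a → guard (P? a) (f a)) ≡ 0ℤ
  ∑-involution {f} φ closed inv anti = i≡-i⇒i≡0 (begin
    ∑ xs (λ a → guard (P? a) (f a))
      ≡⟨ ∑-bijection _≟A_ _≟A_ P? P? enum enum φ φ closed inv closed inv
           (λ p → trans (sym (ℤ.neg-involutive _)) (trans (cong -_ (sym (anti p))) (sym (ℤ.-1*i≡-i _)))) ⟩
    ∑ xs (λ a → guard (P? a) (-1ℤ * f a))  ≡⟨ ∑-cong xs (λ a → guard-* (P? a) -1ℤ (f a)) ⟩
    ∑ xs (λ a → -1ℤ * guard (P? a) (f a))  ≡⟨ ∑-* xs -1ℤ _ ⟩
    -1ℤ * ∑ xs (λ a → guard (P? a) (f a))  ≡⟨ ℤ.-1*i≡-i _ ⟩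
    - ∑ xs (λ a → guard (P? a) (f a))      ∎)
    where open ≡-Reasoning

-- Boxes of integers

intsUpTo-unique : ∀ M → Unique (intsUpTo M)
intsUpTo-unique M = Unique.map⁺ (λ {i} {j} eq → ℤ.+-injective (∙-cancelʳ (- + M) (+ i) (+ j) eq)) (Unique.upTo⁺ _)

-- The integer i sits at position i + M, which is nonnegative and at most 2 M.
∈-intsUpTo : ∀ {M} i → ∣ i ∣ ℕ.≤ M → i ∈ intsUpTo M
∈-intsUpTo {M} i ∣i∣≤M = subst (_∈ intsUpTo M) shift (∈-map⁺ _ (∈-upTo⁺ bound))
  where
  0≤i+M : 0ℤ ≤ i + + M
  0≤i+M = ℤ.≤-trans (ℤ.i≤j⇒0≤j-i (+≤+ ∣i∣≤M))
                    (subst (_≤ i + + M) (ℤ.+-comm (- + ∣ i ∣) (+ M)) (ℤ.+-monoˡ-≤ (+ M) (-∣i∣≤i i)))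
    where
    -∣i∣≤i : ∀ i → - + ∣ i ∣ ≤ i
    -∣i∣≤i (+ n)    = ℤ.neg-≤-pos
    -∣i∣≤i -[1+ n ] = ℤ.≤-refl
  bound : ∣ i + + M ∣ ℕ.< M ℕ.+ M ℕ.+ 1
  bound = subst (∣ i + + M ∣ ℕ.<_) (ℕ.+-comm 1 (M ℕ.+ M))
                (s≤s (ℕ.≤-trans (ℤ.∣i+j∣≤∣i∣+∣j∣ i (+ M)) (ℕ.+-monoˡ-≤ M ∣i∣≤M)))
  cancel : ∀ a b → a + b - b ≡ a
  cancel = solve-∀
  shift : + ∣ i + + M ∣ - + M ≡ i
  shift = trans (cong (_- + M) (ℤ.0≤i⇒+∣i∣≡i 0≤i+M)) (cancel i (+ M))

-- Signs and parity

-- The sign (-1)^i, also for negative i. It doubles as the parity predicate, "i is odd" being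
-- `ε i ≡ -1ℤ`, so parity arguments become multiplicative computations.
ε : ℤ → ℤ
ε i = -1ℤ ^ ∣ i ∣

ε-+ : ∀ i j → ε (i + j) ≡ ε i * ε j
ε-+ (+ m)    (+ n)    = ℤ.^-distribˡ-+-* -1ℤ m n
ε-+ (+ m)    -[1+ n ] = ε-⊖ m (suc n)
  where
  signs : ∀ a b → a * b ≡ (-1ℤ * a) * (-1ℤ * b)
  signs = solve-∀
  ε-⊖ : ∀ m n → ε (m ⊖ n) ≡ -1ℤ ^ m * -1ℤ ^ n
  ε-⊖ zero    zero    = refl
  ε-⊖ zero    (suc n) = sym (ℤ.*-identityˡ _)
  ε-⊖ (suc m) zero    = sym (ℤ.*-identityʳ _)
  ε-⊖ (suc m) (suc n) = trans (cong ε (ℤ.[1+m]⊖[1+n]≡m⊖n m n)) (trans (ε-⊖ m n) (signs (-1ℤ ^ m) (-1ℤ ^ n)))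
ε-+ -[1+ m ] (+ n)    = trans (cong ε (ℤ.+-comm -[1+ m ] (+ n)))
                              (trans (ε-+ (+ n) -[1+ m ]) (ℤ.*-comm (ε (+ n)) (ε -[1+ m ])))
ε-+ -[1+ m ] -[1+ n ] = trans (cong (-1ℤ ^_) (cong suc (sym (ℕ.+-suc m n)))) (ℤ.^-distribˡ-+-* -1ℤ (suc m) (suc n))

ε-neg : ∀ i → ε (- i) ≡ ε i
ε-neg i = cong (-1ℤ ^_) (ℤ.∣-i∣≡∣i∣ i)

ε-minus : ∀ i j → ε (i - j) ≡ ε i * ε j
ε-minus i j = trans (ε-+ i (- j)) (cong (ε i *_) (ε-neg j))

ε-* : ∀ i j → ε (i * j) ≡ ε i ^ ∣ j ∣
ε-* i j = trans (cong (-1ℤ ^_) (ℤ.abs-* i j)) (sym (ℤ.^-*-assoc -1ℤ ∣ i ∣ ∣ j ∣))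

ε≡±1 : ∀ i → ε i ≡ 1ℤ ⊎ ε i ≡ -1ℤ
ε≡±1 i = go ∣ i ∣
  where
  go : ∀ n → -1ℤ ^ n ≡ 1ℤ ⊎ -1ℤ ^ n ≡ -1ℤ
  go zero = inj₁ refl
  go (suc n) with go n
  ... | inj₁ eq = inj₂ (cong (-1ℤ *_) eq)
  ... | inj₂ eq = inj₁ (cong (-1ℤ *_) eq)

ε-square : ∀ i → ε (i * i) ≡ ε i
ε-square i with ε≡±1 i
... | inj₁ eq = trans (ε-* i i) (trans (cong (_^ ∣ i ∣) eq) (trans (ℤ.^-zeroˡ ∣ i ∣) (sym eq)))
... | inj₂ eq = trans (ε-* i i) (cong (_^ ∣ i ∣) eq)

ε²≡1 : ∀ i → ε i * ε i ≡ 1ℤ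
ε²≡1 i with ε≡±1 i
... | inj₁ eq = cong₂ _*_ eq eq
... | inj₂ eq = cong₂ _*_ eq eq

ε-shift : ∀ i j → ε (i + (j + j)) ≡ ε i
ε-shift i j = trans (ε-+ i (j + j)) (trans (cong (ε i *_) (trans (ε-+ j j) (ε²≡1 j))) (ℤ.*-identityʳ _))

m≡m%2+2*[m/2] : ∀ n → n ≡ n % 2 ℕ.+ 2 ℕ.* (n / 2)
m≡m%2+2*[m/2] n = trans (m≡m%n+[m/n]*n n 2) (cong (n % 2 ℕ.+_) (ℕ.*-comm (n / 2) 2))

-1^n≡-1^n%2 : ∀ n → -1ℤ ^ n ≡ -1ℤ ^ (n % 2)
-1^n≡-1^n%2 n = begin
  -1ℤ ^ n                               ≡⟨ cong (-1ℤ ^_) (m≡m%2+2*[m/2] n) ⟩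
  -1ℤ ^ (n % 2 ℕ.+ 2 ℕ.* (n / 2))       ≡⟨ ℤ.^-distribˡ-+-* -1ℤ (n % 2) (2 ℕ.* (n / 2)) ⟩
  -1ℤ ^ (n % 2) * -1ℤ ^ (2 ℕ.* (n / 2))
    ≡⟨ cong (-1ℤ ^ (n % 2) *_) (trans (sym (ℤ.^-*-assoc -1ℤ 2 (n / 2))) (ℤ.^-zeroˡ (n / 2))) ⟩
  -1ℤ ^ (n % 2) * 1ℤ                    ≡⟨ ℤ.*-identityʳ _ ⟩
  -1ℤ ^ (n % 2)                         ∎
  where open ≡-Reasoning

%2 : ∀ n → n % 2 ≡ 0 ⊎ n % 2 ≡ 1
%2 n with n % 2 | m%n<n n 2
... | 0 | _ = inj₁ refl
... | 1 | _ = inj₂ refl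
... | suc (suc _) | s≤s (s≤s ())

even⇒-1^ : ∀ {n} → n % 2 ≡ 0 → -1ℤ ^ n ≡ 1ℤ
even⇒-1^ {n} eq = trans (-1^n≡-1^n%2 n) (cong (-1ℤ ^_) eq)

odd⇒-1^ : ∀ {n} → n % 2 ≡ 1 → -1ℤ ^ n ≡ -1ℤ
odd⇒-1^ {n} eq = trans (-1^n≡-1^n%2 n) (cong (-1ℤ ^_) eq)

-1^⇒odd : ∀ {n} → -1ℤ ^ n ≡ -1ℤ → n % 2 ≡ 1
-1^⇒odd {n} eq with %2 n
... | inj₂ odd = odd
... | inj₁ even with () ← trans (sym eq) (even⇒-1^ {n} even)

-1^⇒even : ∀ {n} → -1ℤ ^ n ≡ 1ℤ → n % 2 ≡ 0
-1^⇒even {n} eq with %2 n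
... | inj₁ even = even
... | inj₂ odd with () ← trans (sym eq) (odd⇒-1^ {n} odd)

-- Divisor sums over pairs

-- The first entry is the divisor that σ* sums, the second its odd cofactor. The target is an
-- integer because it will be m - x²; a target that is not positive has no pairs.
OddCofactor : ℤ → ℤ × ℤ → Set
OddCofactor z (d , e) = 0ℤ < d × 0ℤ < e × ε e ≡ -1ℤ × d * e ≡ z

oddCofactor? : ∀ z p → Dec (OddCofactor z p)
oddCofactor? z (d , e) = (0ℤ ℤ.<? d) ×-dec (0ℤ ℤ.<? e) ×-dec (ε e ℤ.≟ -1ℤ) ×-dec (d * e ℤ.≟ z)

box² : ℕ → List (ℤ × ℤ)
box² M = cartesianProduct (intsUpTo M) (intsUpTo M)

_≟²_ : DecidableEquality (ℤ × ℤ)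
_≟²_ = ≡-dec ℤ._≟_ ℤ._≟_

oddCofactor-bounds : ∀ {M z d e} → z ≤ + M → OddCofactor z (d , e) → ∣ d ∣ ℕ.≤ M × ∣ e ∣ ℕ.≤ M
oddCofactor-bounds {d = + suc a} {e = + suc b} (+≤+ le) (+<+ _ , +<+ _ , _ , refl) =
  ℕ.≤-trans (ℕ.m≤m*n (suc a) (suc b)) le , ℕ.≤-trans (ℕ.m≤n*m (suc b) (suc a)) le

box²-enumerates : ∀ {M z} → z ≤ + M → box² M Enumerates OddCofactor z
box²-enumerates {M} z≤M =
  Unique.cartesianProduct⁺ (intsUpTo-unique M) (intsUpTo-unique M) ,
  λ p → ∈-cartesianProduct⁺ (∈-intsUpTo _ (proj₁ (oddCofactor-bounds z≤M p)))
                            (∈-intsUpTo _ (proj₂ (oddCofactor-bounds z≤M p)))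

DivisorIndex : ℕ → ℕ → Set
DivisorIndex q i = q % suc i ≡ 0 × q / suc i % 2 ≡ 1

divisorIndex? : ∀ q i → Dec (DivisorIndex q i)
divisorIndex? q i = (q % suc i ℕ.≟ 0) ×-dec (q / suc i % 2 ℕ.≟ 1)

+-sum : ∀ {A : Set} (f : A → ℕ) (xs : List A) → + sum (map f xs) ≡ ∑ xs (λ a → + f a)
+-sum f []       = refl
+-sum f (x ∷ xs) = cong (_+_ (+ f x)) (+-sum f xs)

-- Names the summand of sigmaStar, which uses a conjunction local to Defs.
sigmaStar-summand : ∀ q → Σ (ℕ → ℕ) λ f → sigmaStar (suc q) ≡ sum (map f (upTo (suc q)))
sigmaStar-summand q = _ , refl

sigmaStar-indices : ∀ q → + sigmaStar q ≡ ∑ (upTo q) (λ i → guard (divisorIndex? q i) (+ suc i))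
sigmaStar-indices zero    = refl
sigmaStar-indices (suc q) = trans (+-sum _ (upTo (suc q))) (∑-cong (upTo (suc q)) summand)
  where
  summand : ∀ i → + proj₁ (sigmaStar-summand q) i ≡ guard (divisorIndex? (suc q) i) (+ suc i)
  summand i with suc q % suc i ≡ᵇ 0 | suc q / suc i % 2 ≡ᵇ 1
  ... | true  | true  = refl
  ... | true  | false = refl
  ... | false | _     = refl

divisorIndex-* : ∀ {q i} → DivisorIndex q i → suc i ℕ.* (q / suc i) ≡ q
divisorIndex-* {q} {i} (div , _) =
  trans (ℕ.*-comm (suc i) (q / suc i)) (sym (trans (m≡m%n+[m/n]*n q (suc i)) (cong (ℕ._+ q / suc i ℕ.* suc i) div)))

-- The box size is independent of q so that all values σ*(m - x²) can later be summed over one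
-- common box.
sigmaStar-pairs : ∀ {M} q → q ℕ.≤ M → + sigmaStar q ≡ ∑ (box² M) (λ p → guard (oddCofactor? (+ q) p) (proj₁ p))
sigmaStar-pairs {M} q q≤M =
  trans (sigmaStar-indices q)
        (∑-bijection ℕ._≟_ _≟²_ (divisorIndex? q) (oddCofactor? (+ q))
          (Unique.upTo⁺ q , ∈-upTo⁺ ∘ bound) (box²-enumerates (+≤+ q≤M))
          -- Position i stands for the divisor i + 1, hence the predecessor in the inverse map.
          (λ i → + suc i , + (q / suc i)) (λ (d , _) → ℕ.pred ∣ d ∣)
          pair (λ _ → refl) index pair∘index (λ _ → refl))
  where
  quotient≢0 : ∀ {i} → DivisorIndex q i → 0 ℕ.< q / suc i
  quotient≢0 {i} (_ , odd) with q / suc i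
  ... | suc _ = s≤s z≤n
  bound : ∀ {i} → DivisorIndex q i → i ℕ.< q
  bound {i} p = subst (suc i ℕ.≤_) (divisorIndex-* p) (ℕ.m≤m*n (suc i) (q / suc i) {{ℕ.>-nonZero (quotient≢0 p)}})
  pair : ∀ {i} → DivisorIndex q i → OddCofactor (+ q) (+ suc i , + (q / suc i))
  pair {i} p = +<+ (s≤s z≤n) , +<+ (quotient≢0 p) , odd⇒-1^ {q / suc i} (proj₂ p) ,
               trans (sym (ℤ.pos-* (suc i) (q / suc i))) (cong +_ (divisorIndex-* p))
  divide : ∀ a b → (suc a ℕ.* suc b) % suc a ≡ 0 × suc a ℕ.* suc b / suc a ≡ suc b
  divide a b rewrite ℕ.*-comm (suc a) (suc b) = m*n%n≡0 (suc b) (suc a) , m*n/n≡m (suc b) (suc a)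
  index : ∀ {p} → OddCofactor (+ q) p → DivisorIndex q (ℕ.pred ∣ proj₁ p ∣)
  index {+ suc a , + suc b} (+<+ _ , +<+ _ , odd , refl) =
    proj₁ (divide a b) , trans (cong (_% 2) (proj₂ (divide a b))) (-1^⇒odd {suc b} odd)
  pair∘index : ∀ {p} → OddCofactor (+ q) p → (+ suc (ℕ.pred ∣ proj₁ p ∣) , + (q / suc (ℕ.pred ∣ proj₁ p ∣))) ≡ p
  pair∘index {+ suc a , + suc b} (+<+ _ , +<+ _ , _ , refl) = cong (λ e → + suc a , + e) (proj₂ (divide a b))

even⇒2*[n/2]≡n : ∀ {n} → n % 2 ≡ 0 → 2 ℕ.* (n / 2) ≡ n
even⇒2*[n/2]≡n {n} even = sym (trans (m≡m%2+2*[m/2] n) (cong (ℕ._+ 2 ℕ.* (n / 2)) even))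

-- Doubling d while keeping the odd cofactor e maps the pairs of q / 2 to those of q. It is onto
-- because an even product d e with e odd forces d to be even.
sigmaStar-even : ∀ {q} → q % 2 ≡ 0 → + 2 * + sigmaStar (q / 2) ≡ + sigmaStar q
sigmaStar-even {q} q-even = begin
  + 2 * + sigmaStar (q / 2)
    ≡⟨ cong (+ 2 *_) (sigmaStar-pairs {q} (q / 2) (m/n≤m q 2)) ⟩
  + 2 * ∑ (box² q) (λ p → guard (oddCofactor? (+ (q / 2)) p) (proj₁ p))
    ≡⟨ ∑-* (box² q) (+ 2) _ ⟨
  ∑ (box² q) (λ p → + 2 * guard (oddCofactor? (+ (q / 2)) p) (proj₁ p))
    ≡⟨ ∑-cong (box² q) (λ p → guard-* (oddCofactor? (+ (q / 2)) p) (+ 2) (proj₁ p)) ⟨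
  ∑ (box² q) (λ p → guard (oddCofactor? (+ (q / 2)) p) (+ 2 * proj₁ p))
    ≡⟨ ∑-bijection _≟²_ _≟²_ (oddCofactor? (+ (q / 2))) (oddCofactor? (+ q))
         (box²-enumerates (+≤+ (m/n≤m q 2))) (box²-enumerates ℤ.≤-refl)
         (λ (d , e) → + 2 * d , e) (λ (d , e) → + (∣ d ∣ / 2) , e)
         doubled halve∘double halved double∘halve (λ _ → refl) ⟩
  ∑ (box² q) (λ p → guard (oddCofactor? (+ q) p) (proj₁ p))
    ≡⟨ sigmaStar-pairs q ℕ.≤-refl ⟨
  + sigmaStar q ∎
  where
  open ≡-Reasoning
  2*[q/2] : + 2 * + (q / 2) ≡ + q
  2*[q/2] = trans (sym (ℤ.pos-* 2 (q / 2))) (cong +_ (even⇒2*[n/2]≡n q-even))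
  doubled : ∀ {p} → OddCofactor (+ (q / 2)) p → OddCofactor (+ q) (+ 2 * proj₁ p , proj₂ p)
  doubled {d , e} (0<d , 0<e , odd , eq) =
    ℤ.*-monoˡ-<-pos (+ 2) 0<d , 0<e , odd ,
    trans (ℤ.*-assoc (+ 2) d e) (trans (cong (+ 2 *_) eq) 2*[q/2])
  halve∘double : ∀ {p} → OddCofactor (+ (q / 2)) p → (+ (∣ + 2 * proj₁ p ∣ / 2) , proj₂ p) ≡ p
  halve∘double {+ suc a , e} (+<+ _ , _) =
    cong (λ d → + d , e) (trans (cong (_/ 2) (ℕ.*-comm 2 (suc a))) (m*n/n≡m (suc a) 2))
  double∘halve′ : ∀ {d e} → OddCofactor (+ q) (d , e) → + 2 * + (∣ d ∣ / 2) ≡ d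
  double∘halve′ {d} {e} (0<d , 0<e , odd , eq) =
    trans (sym (ℤ.pos-* 2 (∣ d ∣ / 2)))
          (trans (cong +_ (even⇒2*[n/2]≡n (-1^⇒even {∣ d ∣} d-even))) (ℤ.0≤i⇒+∣i∣≡i (ℤ.<⇒≤ 0<d)))
    where
    d-even : ε d ≡ 1ℤ
    d-even = begin
      ε d            ≡⟨ cong (_^ ∣ d ∣) odd ⟨
      ε e ^ ∣ d ∣    ≡⟨ ε-* e d ⟨
      ε (e * d)      ≡⟨ cong ε (trans (ℤ.*-comm e d) eq) ⟩
      ε (+ q)        ≡⟨ even⇒-1^ {q} q-even ⟩
      1ℤ             ∎
  double∘halve : ∀ {p} → OddCofactor (+ q) p → (+ 2 * + (∣ proj₁ p ∣ / 2) , proj₂ p) ≡ p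
  double∘halve p = cong (_, _) (double∘halve′ p)
  halved : ∀ {p} → OddCofactor (+ q) p → OddCofactor (+ (q / 2)) (+ (∣ proj₁ p ∣ / 2) , proj₂ p)
  halved {d , e} p@(0<d , 0<e , odd , eq) =
    ℤ.*-cancelˡ-<-nonNeg (+ 2) (subst (0ℤ <_) (sym (double∘halve′ p)) 0<d) , 0<e , odd ,
    ℤ.*-cancelˡ-≡ (+ 2) _ _ (begin
      + 2 * (+ (∣ d ∣ / 2) * e) ≡⟨ ℤ.*-assoc (+ 2) (+ (∣ d ∣ / 2)) e ⟨
      + 2 * + (∣ d ∣ / 2) * e   ≡⟨ cong (_* e) (double∘halve′ p) ⟩
      d * e                     ≡⟨ eq ⟩
      + q                       ≡⟨ 2*[q/2] ⟨
      + 2 * + (q / 2)           ∎)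

-- Vanishing on negative arguments, as also at 0, lets G (m - x²) be summed over a whole box without
-- the condition x² ≤ m.
G : ℤ → ℤ
G (+ q)    = + sigmaStar q - + 4 * + sigmaStarHalf q
G -[1+ _ ] = 0ℤ

-- For odd q the half term is absent; for even q it is 4 σ*(q/2) = 2 σ*(q), which turns σ*(q) into
-- -σ*(q).
G-sigmaStar : ∀ q → G (+ q) ≡ -1ℤ * ε (+ q) * + sigmaStar q
G-sigmaStar q with %2 q
... | inj₂ odd = begin
  + sigmaStar q - + 4 * + sigmaStarHalf q
    ≡⟨ cong (λ b → + sigmaStar q - + 4 * + (if b ≡ᵇ 0 then sigmaStar (q / 2) else 0)) odd ⟩
  + sigmaStar q - 0ℤ                        ≡⟨ ring (+ sigmaStar q) ⟩
  -1ℤ * -1ℤ * + sigmaStar q                 ≡⟨ cong (λ s → -1ℤ * s * + sigmaStar q) (odd⇒-1^ {q} odd) ⟨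
  -1ℤ * ε (+ q) * + sigmaStar q             ∎
  where
  open ≡-Reasoning
  ring : ∀ a → a - 0ℤ ≡ -1ℤ * -1ℤ * a
  ring = solve-∀
... | inj₁ even = begin
  + sigmaStar q - + 4 * + sigmaStarHalf q
    ≡⟨ cong (λ b → + sigmaStar q - + 4 * + (if b ≡ᵇ 0 then sigmaStar (q / 2) else 0)) even ⟩
  + sigmaStar q - + 4 * + sigmaStar (q / 2) ≡⟨ cong (_- + 4 * + sigmaStar (q / 2)) (sigmaStar-even {q} even) ⟨
  + 2 * + sigmaStar (q / 2) - + 4 * + sigmaStar (q / 2) ≡⟨ ring (+ sigmaStar (q / 2)) ⟩
  -1ℤ * 1ℤ * (+ 2 * + sigmaStar (q / 2))
    ≡⟨ cong₂ (λ s t → -1ℤ * s * t) (sym (even⇒-1^ {q} even)) (sigmaStar-even {q} even) ⟩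
  -1ℤ * ε (+ q) * + sigmaStar q             ∎
  where
  open ≡-Reasoning
  ring : ∀ a → + 2 * a - + 4 * a ≡ -1ℤ * 1ℤ * (+ 2 * a)
  ring = solve-∀

oddCofactor-positive : ∀ {z p} → OddCofactor z p → 0ℤ < z
oddCofactor-positive {p = + suc _ , + suc _} (+<+ _ , +<+ _ , _ , refl) = +<+ (s≤s z≤n)

G-pairs : ∀ {M z} → z ≤ + M → G z ≡ -1ℤ * ε z * ∑ (box² M) (λ p → guard (oddCofactor? z p) (proj₁ p))
G-pairs {z = + q} (+≤+ q≤M) = trans (G-sigmaStar q) (cong (-1ℤ * ε (+ q) *_) (sigmaStar-pairs q q≤M))
G-pairs {M} {z@(-[1+ n ])} _ = sym (trans
  (cong (-1ℤ * ε z *_) (∑-zero (box² M) λ {p} _ →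
    guard-no (oddCofactor? z p) (negative ∘ oddCofactor-positive {z} {p}) (proj₁ p)))
  (ℤ.*-zeroʳ (-1ℤ * ε z)))
  where
  negative : ¬ 0ℤ < z
  negative ()

-- Solutions of x² + d e = m

-- Reduces each inequality required of the image of an involution to a given inequality and a ring
-- identity between the two differences.
<-by-difference : ∀ {i j k l} → j - i ≡ l - k → i < j → k < l
<-by-difference {i} {j} {k} {l} eq i<j = subst₂ _<_ (lower i k) upper (ℤ.+-monoˡ-< (k - i) i<j)
  where
  lower : ∀ i k → i + (k - i) ≡ k
  lower = solve-∀
  regroup : ∀ i j k → j + (k - i) ≡ j - i + k
  regroup = solve-∀
  cancel : ∀ k l → l - k + k ≡ l
  cancel = solve-∀
  upper : j + (k - i) ≡ l
  upper = trans (regroup i j k) (trans (cong (_+ k) eq) (cancel k l))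

i≤i*i : ∀ i → + ∣ i ∣ ≤ i * i
i≤i*i i = subst (+ ∣ i ∣ ≤_) (square i) (+≤+ (n≤n*n ∣ i ∣))
  where
  n≤n*n : ∀ n → n ℕ.≤ n ℕ.* n
  n≤n*n zero      = z≤n
  n≤n*n n@(suc _) = ℕ.m≤m*n n n
  square : ∀ i → + (∣ i ∣ ℕ.* ∣ i ∣) ≡ i * i
  square (+ n)    = ℤ.pos-* n n
  square -[1+ n ] = refl

i²≤M⇒∣i∣≤M : ∀ {M} i → i * i ≤ + M → ∣ i ∣ ℕ.≤ M
i²≤M⇒∣i∣≤M i i²≤M = ℤ.drop‿+≤+ (ℤ.≤-trans (i≤i*i i) i²≤M)

0≤i*i : ∀ i → 0ℤ ≤ i * i
0≤i*i i = ℤ.≤-trans (+≤+ z≤n) (i≤i*i i)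

m-i²≤m : ∀ m i → m - i * i ≤ m
m-i²≤m m i = subst (m - i * i ≤_) (ℤ.+-identityʳ m) (ℤ.+-monoʳ-≤ m (ℤ.neg-mono-≤ (0≤i*i i)))

-- A triple (x , d , e) encodes the solution x² + d e = m with d, e > 0 and e odd.
Triple : Set
Triple = ℤ × ℤ × ℤ

_≟³_ : DecidableEquality Triple
_≟³_ = ≡-dec ℤ._≟_ _≟²_

triple≡ : {x x′ d d′ e e′ : ℤ} → x ≡ x′ → d ≡ d′ → e ≡ e′ → (x , d , e) ≡ (x′ , d′ , e′)
triple≡ refl refl refl = refl

Solution : ℤ → Triple → Set
Solution m (x , p) = OddCofactor (m - x * x) p

solution? : ∀ m t → Dec (Solution m t)
solution? m (x , p) = oddCofactor? (m - x * x) p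

box³ : ℕ → List Triple
box³ M = cartesianProduct (intsUpTo M) (box² M)

box³-enumerates : ∀ {M m} → m ≤ + M → {C : Triple → Set} → box³ M Enumerates (λ t → Solution m t × C t)
box³-enumerates {M} {m} m≤M =
  Unique.cartesianProduct⁺ (intsUpTo-unique M) (proj₁ (box²-enumerates m≤M)) , λ { {x , p} (sol , _) → member x p sol }
  where
  member : ∀ x p → Solution m (x , p) → (x , p) ∈ box³ M
  member x p sol = ∈-cartesianProduct⁺
    (∈-intsUpTo x (i²≤M⇒∣i∣≤M x (ℤ.≤-trans (ℤ.<⇒≤ (<-by-difference diff (oddCofactor-positive {p = p} sol))) m≤M)))
    (proj₂ (box²-enumerates (ℤ.≤-trans (m-i²≤m m x) m≤M)) sol)
    where
    diff : m - x * x - 0ℤ ≡ m - x * x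
    diff = ℤ.+-identityʳ _

-- Eliminates m: that the image solves the same equation becomes the ring identity d′ e′ + x′² = d e
-- + x².
transport : ∀ {m x d e} x′ d′ e′ → d * e ≡ m - x * x →
            d′ * e′ ≡ d * e + (x * x - x′ * x′) → d′ * e′ ≡ m - x′ * x′
transport {m} {x} x′ d′ e′ eq eq′ = trans eq′ (trans (cong (_+ (x * x - x′ * x′)) eq) (ring m x x′))
  where
  ring : ∀ m x y → m - x * x + (x * x - y * y) ≡ m - y * y
  ring = solve-∀

-- Sign-reversing involutions

weight : Triple → ℤ
weight (x , d , e) = ε x * (x + d)

weight-negate-ε : ∀ {s s′ a a′} → s′ ≡ -1ℤ * s → a′ ≡ a → s′ * a′ ≡ - (s * a)
weight-negate-ε {s} {a = a} refl refl = ring s a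
  where
  ring : ∀ s a → -1ℤ * s * a ≡ - (s * a)
  ring = solve-∀

weight-negate : ∀ {s s′ a a′} → s′ ≡ s → a′ ≡ - a → s′ * a′ ≡ - (s * a)
weight-negate {s} {a = a} refl refl = sym (ℤ.neg-distribʳ-* s a)

-- With f = e - d - 2 x these are f < 0, f = 0 and f > 0, the last split by the sign of d - f + 2 (x + d).
Below Square AboveBelow AboveAbove : Triple → Set
Below      (x , d , e) = e < d + + 2 * x
Square     (x , d , e) = e ≡ d + + 2 * x
AboveBelow (x , d , e) = d + + 2 * x < e × e < + 4 * (x + d)
AboveAbove (x , d , e) = d + + 2 * x < e × + 4 * (x + d) < e

below?      : ∀ t → Dec (Below t)
below?      (x , d , e) = e ℤ.<? d + + 2 * x
square?     : ∀ t → Dec (Square t)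
square?     (x , d , e) = e ℤ.≟ d + + 2 * x
aboveBelow? : ∀ t → Dec (AboveBelow t)
aboveBelow? (x , d , e) = (d + + 2 * x ℤ.<? e) ×-dec (e ℤ.<? + 4 * (x + d))
aboveAbove? : ∀ t → Dec (AboveAbove t)
aboveAbove? (x , d , e) = (d + + 2 * x ℤ.<? e) ×-dec (+ 4 * (x + d) ℤ.<? e)

∑-solutions : ℕ → ℤ → {C : Triple → Set} → (∀ t → Dec (C t)) → ℤ
∑-solutions M m C? = ∑ (box³ M) (λ t → guard (solution? m t ×-dec C? t) (weight t))

module _ {M : ℕ} {m : ℤ} (m≤M : m ≤ + M) where

  ∑-solutions-vanishes : {C : Triple → Set} (C? : ∀ t → Dec (C t)) (φ : Triple → Triple) →
             (∀ {t} → Solution m t × C t → Solution m (φ t) × C (φ t)) →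
             (∀ t → φ (φ t) ≡ t) →
             (∀ {t} → Solution m t × C t → weight (φ t) ≡ - weight t) →
             ∑-solutions M m C? ≡ 0ℤ
  ∑-solutions-vanishes C? φ closed inv anti =
    ∑-involution _≟³_ (λ t → solution? m t ×-dec C? t) (box³-enumerates m≤M) φ closed (λ {t} _ → inv t) anti

  -- This exchanges the factors d and -f of (x + d)² - m.
  below-vanishes : ∑-solutions M m below? ≡ 0ℤ
  below-vanishes = ∑-solutions-vanishes below? φ closed inv anti
    where
    φ : Triple → Triple
    -- Here d′ = -f and x′ = s - d′ with s = x + d unchanged. The image has f = -d < 0, so it lies
    -- in the same class.
    φ (x , d , e) = e - x , d + + 2 * x - e , e
    closed : ∀ {t} → Solution m t × Below t → Solution m (φ t) × Below (φ t)
    closed {x , d , e} ((0<d , 0<e , odd , eq) , lt) =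
      (<-by-difference {e} {d + + 2 * x} {0ℤ} {d + + 2 * x - e} (solve (x ∷ d ∷ e ∷ [])) lt , 0<e , odd ,
       transport {m} {x} {d} {e} (e - x) (d + + 2 * x - e) e eq (solve (x ∷ d ∷ e ∷ []))) ,
      <-by-difference {0ℤ} {d} {e} {d + + 2 * x - e + + 2 * (e - x)} (solve (x ∷ d ∷ e ∷ [])) 0<d
    inv : ∀ t → φ (φ t) ≡ t
    inv (x , d , e) = triple≡ (x″ x e) (d″ x d e) refl
      where
      x″ : ∀ x e → e - (e - x) ≡ x
      x″ = solve-∀
      d″ : ∀ x d e → d + + 2 * x - e + + 2 * (e - x) - e ≡ d
      d″ = solve-∀
    anti : ∀ {t} → Solution m t × Below t → weight (φ t) ≡ - weight t
    anti {x , d , e} ((_ , _ , odd , _) , _) =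
      weight-negate-ε (trans (ε-minus e x) (cong (_* ε x) odd)) (x+d x d e)
      where
      x+d : ∀ x d e → e - x + (d + + 2 * x - e) ≡ x + d
      x+d = solve-∀

  -- This exchanges the factors d and f of m - (x + d)².
  aboveBelow-vanishes : ∑-solutions M m aboveBelow? ≡ 0ℤ
  aboveBelow-vanishes = ∑-solutions-vanishes aboveBelow? φ closed inv anti
    where
    φ : Triple → Triple
    -- Here d′ = f, x′ = s - f and e′ = d - f + 2 s = 4 s - e. The bound e < 4 s makes e′ positive,
    -- and e > 0 gives the same bound for e′.
    φ (x , d , e) = + 3 * x + + 2 * d - e , e - d - + 2 * x , + 4 * (x + d) - e
    odd′ : ∀ x d e → ε (+ 4 * (x + d) - e) ≡ ε e
    odd′ x d e = trans (cong ε (shift x d e)) (trans (ε-shift (- e) (+ 2 * (x + d))) (ε-neg e))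
      where
      shift : ∀ x d e → + 4 * (x + d) - e ≡ - e + (+ 2 * (x + d) + + 2 * (x + d))
      shift = solve-∀
    closed : ∀ {t} → Solution m t × AboveBelow t → Solution m (φ t) × AboveBelow (φ t)
    closed {x , d , e} ((0<d , 0<e , odd , eq) , lt , lt′) =
      (<-by-difference {d + + 2 * x} {e} {0ℤ} {e - d - + 2 * x} (solve (x ∷ d ∷ e ∷ [])) lt ,
       <-by-difference {e} {+ 4 * (x + d)} {0ℤ} {+ 4 * (x + d) - e} (solve (x ∷ d ∷ e ∷ [])) lt′ ,
       trans (odd′ x d e) odd ,
       transport {m} {x} {d} {e} (+ 3 * x + + 2 * d - e) (e - d - + 2 * x) (+ 4 * (x + d) - e) eq
         (solve (x ∷ d ∷ e ∷ []))) ,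
      <-by-difference {0ℤ} {d} {e - d - + 2 * x + + 2 * (+ 3 * x + + 2 * d - e)} {+ 4 * (x + d) - e}
        (solve (x ∷ d ∷ e ∷ [])) 0<d ,
      <-by-difference {0ℤ} {e} {+ 4 * (x + d) - e} {+ 4 * (+ 3 * x + + 2 * d - e + (e - d - + 2 * x))}
        (solve (x ∷ d ∷ e ∷ [])) 0<e
    inv : ∀ t → φ (φ t) ≡ t
    inv (x , d , e) = triple≡ (x″ x d e) (d″ x d e) (e″ x d e)
      where
      x″ : ∀ x d e → + 3 * (+ 3 * x + + 2 * d - e) + + 2 * (e - d - + 2 * x) - (+ 4 * (x + d) - e) ≡ x
      x″ = solve-∀
      d″ : ∀ x d e → + 4 * (x + d) - e - (e - d - + 2 * x) - + 2 * (+ 3 * x + + 2 * d - e) ≡ d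
      d″ = solve-∀
      e″ : ∀ x d e → + 4 * (+ 3 * x + + 2 * d - e + (e - d - + 2 * x)) - (+ 4 * (x + d) - e) ≡ e
      e″ = solve-∀
    anti : ∀ {t} → Solution m t × AboveBelow t → weight (φ t) ≡ - weight t
    anti {x , d , e} ((_ , _ , odd , _) , _) = weight-negate-ε sign (x+d x d e)
      where
      x+d : ∀ x d e → + 3 * x + + 2 * d - e + (e - d - + 2 * x) ≡ x + d
      x+d = solve-∀
      shift : ∀ x d e → + 3 * x + + 2 * d - e ≡ (x - e) + ((x + d) + (x + d))
      shift = solve-∀
      sign : ε (+ 3 * x + + 2 * d - e) ≡ -1ℤ * ε x
      sign = trans (cong ε (shift x d e)) (trans (ε-shift (x - e) (x + d))
                   (trans (ε-minus x e) (trans (cong (ε x *_) odd) (ℤ.*-comm (ε x) -1ℤ))))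

  -- This keeps d and f and negates x + d.
  aboveAbove-vanishes : ∑-solutions M m aboveAbove? ≡ 0ℤ
  aboveAbove-vanishes = ∑-solutions-vanishes aboveAbove? φ closed inv anti
    where
    φ : Triple → Triple
    -- Here x′ = -s - d and e′ = f - d - 2 s = e - 4 s, positive by the second bound. The parity of
    -- x is kept, so the sign change of the weight comes from s alone.
    φ (x , d , e) = - x - + 2 * d , d , e - + 4 * (x + d)
    odd′ : ∀ x d e → ε (e - + 4 * (x + d)) ≡ ε e
    odd′ x d e = trans (cong ε (shift x d e)) (ε-shift e (- (+ 2 * (x + d))))
      where
      shift : ∀ x d e → e - + 4 * (x + d) ≡ e + (- (+ 2 * (x + d)) + - (+ 2 * (x + d)))
      shift = solve-∀
    closed : ∀ {t} → Solution m t × AboveAbove t → Solution m (φ t) × AboveAbove (φ t)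
    closed {x , d , e} ((0<d , 0<e , odd , eq) , lt , lt′) =
      (0<d ,
       <-by-difference {+ 4 * (x + d)} {e} {0ℤ} {e - + 4 * (x + d)} (solve (x ∷ d ∷ e ∷ [])) lt′ ,
       trans (odd′ x d e) odd ,
       transport {m} {x} {d} {e} (- x - + 2 * d) d (e - + 4 * (x + d)) eq (solve (x ∷ d ∷ e ∷ []))) ,
      <-by-difference {d + + 2 * x} {e} {d + + 2 * (- x - + 2 * d)} {e - + 4 * (x + d)} (solve (x ∷ d ∷ e ∷ [])) lt ,
      <-by-difference {0ℤ} {e} {+ 4 * (- x - + 2 * d + d)} {e - + 4 * (x + d)} (solve (x ∷ d ∷ e ∷ [])) 0<e
    inv : ∀ t → φ (φ t) ≡ t
    inv (x , d , e) = triple≡ (x″ x d) refl (e″ x d e)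
      where
      x″ : ∀ x d → - (- x - + 2 * d) - + 2 * d ≡ x
      x″ = solve-∀
      e″ : ∀ x d e → e - + 4 * (x + d) - + 4 * (- x - + 2 * d + d) ≡ e
      e″ = solve-∀
    anti : ∀ {t} → Solution m t × AboveAbove t → weight (φ t) ≡ - weight t
    anti {x , d , e} _ = weight-negate sign (x+d x d)
      where
      x+d : ∀ x d → - x - + 2 * d + d ≡ - (x + d)
      x+d = solve-∀
      shift : ∀ x d → - x - + 2 * d ≡ - x + (- d + - d)
      shift = solve-∀
      sign : ε (- x - + 2 * d) ≡ ε x
      sign = trans (cong ε (shift x d)) (trans (ε-shift (- x) (- d)) (ε-neg x))

-- The terms with f = 0

oddℤ : ℕ → ℤ
oddℤ i = 1ℤ + (+ i + + i)

⌊∣oddℤ∣/2⌋ : ∀ i → ⌊ ∣ oddℤ i ∣ /2⌋ ≡ i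
-- By definition ⌈ k /2⌉ is ⌊ suc k /2⌋, here with k = i + i.
⌊∣oddℤ∣/2⌋ i = sym (ℕ.n≡⌈n+n/2⌉ i)

odd⇒oddℤ : ∀ {e} → 0ℤ < e → ε e ≡ -1ℤ → oddℤ ⌊ ∣ e ∣ /2⌋ ≡ e
odd⇒oddℤ {+ n} _ odd = trans (cong (λ k → oddℤ ⌊ k /2⌋) n-odd)
                             (trans (cong oddℤ (⌊∣oddℤ∣/2⌋ (n / 2))) (cong +_ (sym n-odd)))
  where
  n-odd : n ≡ suc (n / 2 ℕ.+ n / 2)
  n-odd = trans (m≡m%2+2*[m/2] n) (cong₂ ℕ._+_ (-1^⇒odd {n} odd) (cong (n / 2 ℕ.+_) (ℕ.+-identityʳ (n / 2))))

-- The index i encodes the odd number e = 2 i + 1, and i < s says e < 2 s, that is d > 0. As i is a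
-- natural number, it also forces s > 0.
SquareIndex : ℤ → ℤ × ℕ → Set
SquareIndex m (s , i) = + i < s × s * s ≡ m

squareIndex? : ∀ m p → Dec (SquareIndex m p)
squareIndex? m (s , i) = (+ i ℤ.<? s) ×-dec (s * s ℤ.≟ m)

PositiveRoot : ℤ → ℤ → Set
PositiveRoot m s = 0ℤ < s × s * s ≡ m

positiveRoot? : ∀ m s → Dec (PositiveRoot m s)
positiveRoot? m s = (0ℤ ℤ.<? s) ×-dec (s * s ℤ.≟ m)

module _ {M : ℕ} {m : ℤ} (m≤M : m ≤ + M) where

  root-bound : ∀ {s} → s * s ≡ m → ∣ s ∣ ℕ.≤ M
  root-bound {s} refl = i²≤M⇒∣i∣≤M s m≤M

  squareIndex-enumerates : cartesianProduct (intsUpTo M) (upTo M) Enumerates SquareIndex m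
  squareIndex-enumerates =
    Unique.cartesianProduct⁺ (intsUpTo-unique M) (Unique.upTo⁺ M) ,
    λ { {s@(+ _) , i} (+<+ i<s , eq) →
        ∈-cartesianProduct⁺ (∈-intsUpTo s (root-bound {s} eq)) (∈-upTo⁺ (ℕ.<-≤-trans i<s (root-bound {s} eq))) }

  -- A root s of s² = m arises from the s odd numbers e < 2 s, with d = 2 s - e.
  square-indices : ∑-solutions M m square? ≡
                   ∑ (cartesianProduct (intsUpTo M) (upTo M)) (λ p → guard (squareIndex? m p) (-1ℤ * ε m * proj₁ p))
  square-indices =
    ∑-bijection _≟³_ (≡-dec ℤ._≟_ ℕ._≟_) (λ t → solution? m t ×-dec square? t) (squareIndex? m)
      (box³-enumerates m≤M) squareIndex-enumerates
      (λ (x , d , e) → x + d , ⌊ ∣ e ∣ /2⌋) (λ (s , i) → oddℤ i - s , s + s - oddℤ i , oddℤ i)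
      index triple∘index triple index∘triple weight≡
    where
    index : ∀ {t@(x , d , e) : Triple} → Solution m t × Square t → SquareIndex m (x + d , ⌊ ∣ e ∣ /2⌋)
    index {x , d , e} ((0<d , 0<e , odd , eq) , sq) =
      -- With e = 2 k + 1, and 2 (x + d) - e = d > 0 since f = 0, one gets 2 k < e < 2 (x + d).
      ℤ.*-cancelˡ-<-nonNeg (+ 2) (ℤ.<-trans 2k<e e<2s) , root
      where
      k = + ⌊ ∣ e ∣ /2⌋
      2k<e : + 2 * k < e
      2k<e = <-by-difference {0ℤ} {1ℤ} (trans (ring k) (cong (_- + 2 * k) (odd⇒oddℤ 0<e odd))) (+<+ (s≤s z≤n))
        where
        ring : ∀ k → 1ℤ ≡ 1ℤ + (k + k) - + 2 * k
        ring = solve-∀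
      e<2s : e < + 2 * (x + d)
      e<2s = <-by-difference {0ℤ} {d} (trans (ring x d) (cong (_-_ (+ 2 * (x + d))) (sym sq))) 0<d
        where
        ring : ∀ x d → d - 0ℤ ≡ + 2 * (x + d) - (d + + 2 * x)
        ring = solve-∀
      root : (x + d) * (x + d) ≡ m
      root = trans (expand x d) (trans (cong (λ z → d * z + x * x) (sym sq)) (trans (cong (_+ x * x) eq) (cancel m x)))
        where
        expand : ∀ x d → (x + d) * (x + d) ≡ d * (d + + 2 * x) + x * x
        expand = solve-∀
        cancel : ∀ m x → m - x * x + x * x ≡ m
        cancel = solve-∀
    triple∘index : ∀ {t@(x , d , e) : Triple} → Solution m t × Square t →
                   (oddℤ ⌊ ∣ e ∣ /2⌋ - (x + d) , x + d + (x + d) - oddℤ ⌊ ∣ e ∣ /2⌋ , oddℤ ⌊ ∣ e ∣ /2⌋) ≡ t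
    triple∘index {x , d , e} ((_ , 0<e , odd , _) , sq) =
      triple≡ (trans (cong (_- (x + d)) e≡) (x″ x d)) (trans (cong (_-_ (x + d + (x + d))) e≡) (d″ x d))
              (odd⇒oddℤ 0<e odd)
      where
      e≡ : oddℤ ⌊ ∣ e ∣ /2⌋ ≡ d + + 2 * x
      e≡ = trans (odd⇒oddℤ 0<e odd) sq
      x″ : ∀ x d → d + + 2 * x - (x + d) ≡ x
      x″ = solve-∀
      d″ : ∀ x d → x + d + (x + d) - (d + + 2 * x) ≡ d
      d″ = solve-∀
    triple : ∀ {p@(s , i) : ℤ × ℕ} → SquareIndex m p →
             Solution m (oddℤ i - s , s + s - oddℤ i , oddℤ i) × Square (oddℤ i - s , s + s - oddℤ i , oddℤ i)
    triple {s , i} (i<s , refl) =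
      -- Adding i + 1 ≤ s and i < s gives 2 i + 1 < 2 s, so d is positive.
      (<-by-difference (diff s (+ i)) (ℤ.+-mono-≤-< i+1≤s i<s) , +<+ (s≤s z≤n) , ε-shift 1ℤ (+ i) ,
       product s (+ i)) , square s (+ i)
      where
      i+1≤s : 1ℤ + + i ≤ s
      i+1≤s = ℤ.i<j⇒suc[i]≤j i<s
      diff : ∀ s i → s + s - (1ℤ + i + i) ≡ s + s - (1ℤ + (i + i)) - 0ℤ
      diff = solve-∀
      product : ∀ s i → (s + s - (1ℤ + (i + i))) * (1ℤ + (i + i)) ≡ s * s - (1ℤ + (i + i) - s) * (1ℤ + (i + i) - s)
      product = solve-∀
      square : ∀ s i → 1ℤ + (i + i) ≡ s + s - (1ℤ + (i + i)) + + 2 * (1ℤ + (i + i) - s)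
      square = solve-∀
    index∘triple : ∀ {p@(s , i) : ℤ × ℕ} → SquareIndex m p →
                   (oddℤ i - s + (s + s - oddℤ i) , ⌊ ∣ oddℤ i ∣ /2⌋) ≡ p
    index∘triple {s , i} _ = cong₂ _,_ (cancel s (oddℤ i)) (⌊∣oddℤ∣/2⌋ i)
      where
      cancel : ∀ s o → o - s + (s + s - o) ≡ s
      cancel = solve-∀
    -- Since f = 0 means x = e - s with e odd, the sign (-1)^x is -(-1)^s, and s has the parity of
    -- s² = m.
    weight≡ : ∀ {t@(x , d , e) : Triple} → Solution m t × Square t → weight t ≡ -1ℤ * ε m * (x + d)
    weight≡ {t@(x , d , e)} p@((_ , _ , odd , _) , sq) = cong (_* (x + d)) (begin
      ε x                       ≡⟨ cong ε (x≡ x d) ⟩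
      ε (d + + 2 * x - (x + d)) ≡⟨ cong (λ z → ε (z - (x + d))) sq ⟨
      ε (e - (x + d))           ≡⟨ ε-minus e (x + d) ⟩
      ε e * ε (x + d)           ≡⟨ cong₂ _*_ odd (trans (sym (ε-square (x + d))) (cong ε (proj₂ (index p)))) ⟩
      -1ℤ * ε m                 ∎)
      where
      open ≡-Reasoning
      x≡ : ∀ x d → x ≡ d + + 2 * x - (x + d)
      x≡ = solve-∀

  -- A positive root s has the s indices i < s, each contributing s, in total s² = m.
  ∑-squareIndex : ∀ s → ∑ (upTo M) (λ i → guard (squareIndex? m (s , i)) s) ≡ guard (positiveRoot? m s) m
  ∑-squareIndex s = by-cases (positiveRoot? m s)
   where
   by-cases : (root? : Dec (PositiveRoot m s)) → ∑ (upTo M) (λ i → guard (squareIndex? m (s , i)) s) ≡ guard root? m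
   by-cases (no ¬root) = ∑-zero (upTo M) λ {i} _ →
    guard-no (squareIndex? m (s , i)) (λ { (i<s , eq) → ¬root (ℤ.≤-<-trans (+≤+ z≤n) i<s , eq) }) s
   by-cases (yes (+<+ {n = n} _ , eq)) = begin
    ∑ (upTo M) (λ i → guard (squareIndex? m (s , i)) s)
      -- The identity, taken as a bijection, shortens the range from M to n, where s = + n and n ≤ M
      -- because s² = m.
      ≡⟨ ∑-bijection ℕ._≟_ ℕ._≟_ (λ i → squareIndex? m (s , i)) (λ i → squareIndex? m (s , i))
           (Unique.upTo⁺ M , λ { (+<+ i<n , _) → ∈-upTo⁺ (ℕ.<-≤-trans i<n (root-bound {s} eq)) })
           (Unique.upTo⁺ n , λ { (+<+ i<n , _) → ∈-upTo⁺ i<n })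
           id id id (λ _ → refl) id (λ _ → refl) (λ _ → refl) ⟩
    ∑ (upTo n) (λ i → guard (squareIndex? m (s , i)) s)
      ≡⟨ ∑-cong-∈ (upTo n) (λ {i} i∈ → guard-yes (squareIndex? m (s , i)) (+<+ (∈-upTo⁻ i∈) , eq) s) ⟩
    ∑ (upTo n) (λ _ → s)        ≡⟨ ∑-const (upTo n) s ⟩
    + length (upTo n) * s       ≡⟨ cong (λ k → + k * s) (length-upTo n) ⟩
    s * s                       ≡⟨ eq ⟩
    m                           ∎
     where open ≡-Reasoning

  square-sum : ∑-solutions M m square? ≡ -1ℤ * ε m * ∑ (intsUpTo M) (λ s → guard (positiveRoot? m s) m)
  square-sum = begin
    ∑-solutions M m square?
      ≡⟨ square-indices ⟩
    ∑ indices (λ p → guard (squareIndex? m p) (-1ℤ * ε m * proj₁ p))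
      ≡⟨ ∑-cong indices (λ p → guard-* (squareIndex? m p) (-1ℤ * ε m) (proj₁ p)) ⟩
    ∑ indices (λ p → -1ℤ * ε m * guard (squareIndex? m p) (proj₁ p))
      ≡⟨ ∑-* indices (-1ℤ * ε m) _ ⟩
    -1ℤ * ε m * ∑ indices (λ p → guard (squareIndex? m p) (proj₁ p))
      ≡⟨ cong (-1ℤ * ε m *_) (trans (∑-cartesianProduct (intsUpTo M) (upTo M) _) (∑-cong (intsUpTo M) ∑-squareIndex)) ⟩
    -1ℤ * ε m * ∑ (intsUpTo M) (λ s → guard (positiveRoot? m s) m) ∎
    where
    open ≡-Reasoning
    indices = cartesianProduct (intsUpTo M) (upTo M)

-- Splitting the solutions by f

ε-4* : ∀ i → ε (+ 4 * i) ≡ 1ℤ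
ε-4* i = trans (cong ε (double i)) (ε-shift 0ℤ (+ 2 * i))
  where
  double : ∀ i → + 4 * i ≡ 0ℤ + (+ 2 * i + + 2 * i)
  double = solve-∀

sum₄-cong : ∀ {a b c d a′ b′ c′ d′ v : ℤ} → a ≡ a′ → b ≡ b′ → c ≡ c′ → d ≡ d′ →
            a′ + b′ + (c′ + d′) ≡ v → a + b + (c + d) ≡ v
sum₄-cong refl refl refl refl eq = eq

only-first : ∀ v → v + 0ℤ + (0ℤ + 0ℤ) ≡ v
only-first = solve-∀

only-second : ∀ v → 0ℤ + v + (0ℤ + 0ℤ) ≡ v
only-second = solve-∀

only-third : ∀ v → 0ℤ + 0ℤ + (v + 0ℤ) ≡ v
only-third = solve-∀

only-fourth : ∀ v → 0ℤ + 0ℤ + (0ℤ + v) ≡ v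
only-fourth = solve-∀

weight-split : ∀ m t → guard (solution? m t) (weight t) ≡
  guard (solution? m t ×-dec below? t) (weight t) + guard (solution? m t ×-dec square? t) (weight t) +
  (guard (solution? m t ×-dec aboveBelow? t) (weight t) + guard (solution? m t ×-dec aboveAbove? t) (weight t))
weight-split m t@(x , d , e) = split (solution? m t)
  where
  w = weight t
  split : (sol? : Dec (Solution m t)) → guard sol? w ≡
    guard (sol? ×-dec below? t) w + guard (sol? ×-dec square? t) w +
    (guard (sol? ×-dec aboveBelow? t) w + guard (sol? ×-dec aboveAbove? t) w)
  split (no _) = refl
  split (yes (_ , _ , odd , _)) with ℤ.<-cmp e (d + + 2 * x)
  ... | tri< lt ne ngt = sym (sum₄-cong (guard-yes (below? t) lt _) (guard-no (square? t) ne _)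
          (guard-no (aboveBelow? t) (ngt ∘ proj₁) _) (guard-no (aboveAbove? t) (ngt ∘ proj₁) _)
          (only-first (weight t)))
  ... | tri≈ nlt eq ngt = sym (sum₄-cong (guard-no (below? t) nlt _) (guard-yes (square? t) eq _)
          (guard-no (aboveBelow? t) (ngt ∘ proj₁) _) (guard-no (aboveAbove? t) (ngt ∘ proj₁) _)
          (only-second (weight t)))
  ... | tri> nlt ne gt with ℤ.<-cmp e (+ 4 * (x + d))
  ...   | tri< lt′ _ ngt′ = sym (sum₄-cong (guard-no (below? t) nlt _) (guard-no (square? t) ne _)
          (guard-yes (aboveBelow? t) (gt , lt′) _) (guard-no (aboveAbove? t) (ngt′ ∘ proj₂) _)
          (only-third (weight t)))
  ...   | tri> nlt′ _ gt′ = sym (sum₄-cong (guard-no (below? t) nlt _) (guard-no (square? t) ne _)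
          (guard-no (aboveBelow? t) (nlt′ ∘ proj₂) _) (guard-yes (aboveAbove? t) (gt , gt′) _)
          (only-fourth (weight t)))
  -- The only gap between the four classes, e = 4 (x + d), would make e even.
  ...   | tri≈ _ eq′ _ with () ← trans (sym odd) (trans (cong ε eq′) (ε-4* (x + d)))

-- The case k = 1

module _ {M : ℕ} {m : ℤ} (m≤M : m ≤ + M) where

  total : (Triple → ℤ) → ℤ
  total f = ∑ (box³ M) (λ t → guard (solution? m t) (f t))

  weight-total : total weight ≡ ∑-solutions M m square?
  weight-total = begin
    total weight
      ≡⟨ ∑-cong (box³ M) (weight-split m) ⟩
    ∑ (box³ M) (λ t → part below? t + part square? t + (part aboveBelow? t + part aboveAbove? t))
      ≡⟨ ∑-+ (box³ M) (λ t → part below? t + part square? t) (λ t → part aboveBelow? t + part aboveAbove? t) ⟩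
    ∑ (box³ M) (λ t → part below? t + part square? t) + ∑ (box³ M) (λ t → part aboveBelow? t + part aboveAbove? t)
      ≡⟨ cong₂ _+_ (∑-+ (box³ M) (part below?) (part square?)) (∑-+ (box³ M) (part aboveBelow?) (part aboveAbove?)) ⟩
    ∑-solutions M m below? + ∑-solutions M m square? + (∑-solutions M m aboveBelow? + ∑-solutions M m aboveAbove?)
      ≡⟨ sum₄-cong (below-vanishes m≤M) refl (aboveBelow-vanishes m≤M) (aboveAbove-vanishes m≤M) (only-second _) ⟩
    ∑-solutions M m square? ∎
    where
    open ≡-Reasoning
    part : {C : Triple → Set} → (∀ t → Dec (C t)) → Triple → ℤ
    part C? t = guard (solution? m t ×-dec C? t) (weight t)

  total-εx*x : total (λ (x , _) → ε x * x) ≡ 0ℤ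
  total-εx*x = ∑-involution _≟³_ (solution? m)
    (proj₁ (box³-enumerates m≤M {λ _ → ⊤}) , λ sol → proj₂ (box³-enumerates m≤M {λ _ → ⊤}) (sol , tt))
    (λ (x , p) → - x , p)
    (λ {(x , p)} → subst (λ y → OddCofactor (m - y) p) (square x))
    (λ {(x , p)} _ → cong (_, p) (ℤ.neg-involutive x))
    (λ {(x , _)} _ → weight-negate {a = x} (ε-neg x) refl)
    where
    square : ∀ x → x * x ≡ - x * - x
    square = solve-∀

  total-εx*d : total (λ (x , d , _) → ε x * d) ≡ total weight
  total-εx*d = sym (begin
    total weight
      ≡⟨ ∑-cong (box³ M) (λ t@(x , d , _) →
           trans (cong (guard (solution? m t)) (ℤ.*-distribˡ-+ (ε x) x d))
                 (guard-+ (solution? m t) (ε x * x) (ε x * d))) ⟩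
    ∑ (box³ M) (λ t@(x , d , _) → guard (solution? m t) (ε x * x) + guard (solution? m t) (ε x * d))
      ≡⟨ ∑-+ (box³ M) _ _ ⟩
    total (λ (x , _) → ε x * x) + total (λ (x , d , _) → ε x * d)
      ≡⟨ cong (_+ total (λ (x , d , _) → ε x * d)) total-εx*x ⟩
    0ℤ + total (λ (x , d , _) → ε x * d)
      ≡⟨ ℤ.+-identityˡ _ ⟩
    total (λ (x , d , _) → ε x * d) ∎)
    where open ≡-Reasoning

  -- The sign of G (m - x²) depends on the parity of m - x², hence splits into a constant depending
  -- on m and the factor (-1)^x.
  ∑-G-total : ∑ (intsUpTo M) (λ x → G (m - x * x)) ≡ -1ℤ * ε m * total (λ (x , d , _) → ε x * d)
  ∑-G-total = begin
    ∑ (intsUpTo M) (λ x → G (m - x * x))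
      ≡⟨ ∑-cong (intsUpTo M) (λ x → G-pairs {M} (ℤ.≤-trans (m-i²≤m m x) m≤M)) ⟩
    ∑ (intsUpTo M) (λ x → -1ℤ * ε (m - x * x) * S x)
      ≡⟨ ∑-cong (intsUpTo M) (λ x →
           trans (cong (λ s → -1ℤ * s * S x) (trans (ε-minus m (x * x)) (cong (ε m *_) (ε-square x))))
                 (regroup (ε m) (ε x) (S x))) ⟩
    ∑ (intsUpTo M) (λ x → -1ℤ * ε m * (ε x * S x))
      ≡⟨ ∑-* (intsUpTo M) (-1ℤ * ε m) _ ⟩
    -1ℤ * ε m * ∑ (intsUpTo M) (λ x → ε x * S x)
      ≡⟨ cong (-1ℤ * ε m *_) (∑-cong (intsUpTo M) (λ x →
           trans (∑-cong (box² M) (λ p → guard-* (oddCofactor? (m - x * x) p) (ε x) (proj₁ p)))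
                 (∑-* (box² M) (ε x) _))) ⟨
    -1ℤ * ε m * ∑ (intsUpTo M) (λ x → ∑ (box² M) (λ p → guard (solution? m (x , p)) (ε x * proj₁ p)))
      ≡⟨ cong (-1ℤ * ε m *_) (∑-cartesianProduct (intsUpTo M) (box² M) _) ⟨
    -1ℤ * ε m * total (λ (x , d , _) → ε x * d) ∎
    where
    open ≡-Reasoning
    S : ℤ → ℤ
    S x = ∑ (box² M) (λ p → guard (oddCofactor? (m - x * x) p) (proj₁ p))
    regroup : ∀ a b s → -1ℤ * (a * b) * s ≡ -1ℤ * a * (b * s)
    regroup = solve-∀

  -- The constant -(-1)ᵐ occurs twice, once from G and once from the weights with f = 0, and squares
  -- to 1.
  ∑-G-roots : ∑ (intsUpTo M) (λ x → G (m - x * x)) ≡ ∑ (intsUpTo M) (λ s → guard (positiveRoot? m s) m)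
  ∑-G-roots = begin
    ∑ (intsUpTo M) (λ x → G (m - x * x))
      ≡⟨ ∑-G-total ⟩
    -1ℤ * ε m * total (λ (x , d , _) → ε x * d)
      ≡⟨ cong (-1ℤ * ε m *_) (trans total-εx*d (trans weight-total (square-sum m≤M))) ⟩
    -1ℤ * ε m * (-1ℤ * ε m * roots)
      ≡⟨ regroup (ε m) roots ⟩
    ε m * ε m * roots
      ≡⟨ trans (cong (_* roots) (ε²≡1 m)) (ℤ.*-identityˡ roots) ⟩
    roots ∎
    where
    open ≡-Reasoning
    roots = ∑ (intsUpTo M) (λ s → guard (positiveRoot? m s) m)
    regroup : ∀ a s → -1ℤ * a * (-1ℤ * a * s) ≡ a * a * s
    regroup = solve-∀

  ∑-roots : ∑ (intsUpTo M) (λ x → guard (x * x ℤ.≟ m) m) ≡ + 2 * ∑ (intsUpTo M) (λ s → guard (positiveRoot? m s) m)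
  ∑-roots = begin
    ∑ (intsUpTo M) (λ x → guard (x * x ℤ.≟ m) m)
      ≡⟨ ∑-cong (intsUpTo M) signs ⟩
    ∑ (intsUpTo M) (λ x → guard (positiveRoot? m x) m + guard (negativeRoot? x) m)
      ≡⟨ ∑-+ (intsUpTo M) _ _ ⟩
    roots + ∑ (intsUpTo M) (λ x → guard (negativeRoot? x) m)
      ≡⟨ cong (_+_ roots) (∑-bijection ℤ._≟_ ℤ._≟_ negativeRoot? (positiveRoot? m)
           (intsUpTo-unique M , λ {x} p → ∈-intsUpTo x (root-bound m≤M {x} (proj₂ p)))
           (intsUpTo-unique M , λ {x} p → ∈-intsUpTo x (root-bound m≤M {x} (proj₂ p)))
           -_ -_
           (λ {x} (x<0 , eq) → ℤ.neg-mono-< x<0 , trans (sym (square x)) eq) (λ {x} _ → ℤ.neg-involutive x)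
           (λ {x} (0<x , eq) → ℤ.neg-mono-< 0<x , trans (sym (square x)) eq) (λ {x} _ → ℤ.neg-involutive x)
           (λ _ → refl)) ⟩
    roots + roots
      ≡⟨ twice roots ⟩
    + 2 * roots ∎
    where
    open ≡-Reasoning
    roots = ∑ (intsUpTo M) (λ s → guard (positiveRoot? m s) m)
    negativeRoot? : ∀ x → Dec (x < 0ℤ × x * x ≡ m)
    negativeRoot? x = (x ℤ.<? 0ℤ) ×-dec (x * x ℤ.≟ m)
    square : ∀ x → x * x ≡ - x * - x
    square = solve-∀
    twice : ∀ a → a + a ≡ + 2 * a
    twice = solve-∀
    signs : ∀ x → guard (x * x ℤ.≟ m) m ≡ guard (positiveRoot? m x) m + guard (negativeRoot? x) m
    signs x with ℤ.<-cmp x 0ℤ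
    ... | tri< x<0 _ x≯0 = sym (trans (cong₂ _+_ (guard-no (positiveRoot? m x) (x≯0 ∘ proj₁) m)
                                         (guard-cong (negativeRoot? x) (x * x ℤ.≟ m) proj₂ (x<0 ,_) (λ _ → refl)))
                                  (ℤ.+-identityˡ _))
    ... | tri> x≮0 _ 0<x = sym (trans (cong₂ _+_
                                         (guard-cong (positiveRoot? m x) (x * x ℤ.≟ m) proj₂ (0<x ,_) (λ _ → refl))
                                         (guard-no (negativeRoot? x) (x≮0 ∘ proj₁) m))
                                  (ℤ.+-identityʳ _))
    -- The root x = 0 has no partner, but it occurs only for m = 0, where its contribution m
    -- vanishes.
    ... | tri≈ x≮0 refl x≯0 = trans zero-root (sym (cong₂ _+_ (guard-no (positiveRoot? m 0ℤ) (x≯0 ∘ proj₁) m)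
                                                       (guard-no (negativeRoot? 0ℤ) (x≮0 ∘ proj₁) m)))
      where
      zero-root : guard (0ℤ ℤ.≟ m) m ≡ 0ℤ
      zero-root = trans (guard-cong (0ℤ ℤ.≟ m) (0ℤ ℤ.≟ m) id id sym) (guard-zero (0ℤ ℤ.≟ m))

  -- This compares the coefficients of q θ′ and of θ times 2 Σ G(j) q^j. It covers every integer m ≤
  -- M, including negative ones, because the induction on k applies it to m minus a sum of squares.
  theta-identity : ∑ (intsUpTo M) (λ x → guard (x * x ℤ.≟ m) m) ≡ + 2 * ∑ (intsUpTo M) (λ x → G (m - x * x))
  theta-identity = trans ∑-roots (cong (+ 2 *_) (sym ∑-G-roots))

-- Sums over k-tuples

∑-tuples : ∀ k (xs : List ℤ) (f : List ℤ → ℤ) →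
           ∑ (tuples (suc k) xs) f ≡ ∑ xs (λ x → ∑ (tuples k xs) (λ t → f (x ∷ t)))
∑-tuples k xs f = trans (∑-concatMap (λ x → map (x ∷_) (tuples k xs)) xs f)
                        (∑-cong xs (λ x → ∑-map (x ∷_) (tuples k xs) f))

0≤sumSq : ∀ xs → 0ℤ ≤ sumSq xs
0≤sumSq []       = ℤ.≤-refl
0≤sumSq (x ∷ xs) = ℤ.+-mono-≤ (0≤i*i x) (0≤sumSq xs)

i+j≡k⇒j≡k-i : ∀ {i j k} → i + j ≡ k → j ≡ k - i
i+j≡k⇒j≡k-i {i} {j} refl = ring i j
  where
  ring : ∀ i j → j ≡ i + j - i
  ring = solve-∀

j≡k-i⇒i+j≡k : ∀ {i j k} → j ≡ k - i → i + j ≡ k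
j≡k-i⇒i+j≡k {i} {k = k} refl = ring i k
  where
  ring : ∀ i k → i + (k - i) ≡ k
  ring = solve-∀

-- n r_k(n) is the sum of x₁² + … + x_k² over the solutions, to which each coordinate contributes alike.
∑-tuples-G : ∀ k {M m} → m ≤ + M →
  ∑ (tuples k (intsUpTo M)) (λ xs → guard (sumSq xs ℤ.≟ m) m) ≡
  + (2 ℕ.* k) * ∑ (tuples k (intsUpTo M)) (λ xs → G (m - sumSq xs))
∑-tuples-G zero {m = m} _ = trans (ℤ.+-identityʳ _) (zero-sum (0ℤ ℤ.≟ m))
  where
  zero-sum : (0≟m : Dec (0ℤ ≡ m)) → guard 0≟m m ≡ 0ℤ
  zero-sum (yes refl) = refl
  zero-sum (no _)     = refl
∑-tuples-G (suc k) {M} {m} m≤M = begin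
  ∑ (tuples (suc k) box) (λ xs → guard (sumSq xs ℤ.≟ m) m)
    ≡⟨ ∑-tuples k box _ ⟩
  ∑ box (λ x → ∑ ts (λ t → guard (x * x + sumSq t ℤ.≟ m) m))
    -- On a solution, m = (m - x²) + (m - `sumSq t`). Each part equals the target of its own guard,
    -- so the first is an instance of the induction hypothesis for fixed x and the second of the
    -- case k = 1 for fixed t. The box stays the same while the target shrinks.
    ≡⟨ ∑-cong box (λ x → trans (∑-cong ts (split x)) (∑-+ ts (tail x) (head x))) ⟩
  ∑ box (λ x → ∑ ts (tail x) + ∑ ts (head x))
    ≡⟨ ∑-+ box _ _ ⟩
  ∑ box (λ x → ∑ ts (tail x)) + ∑ box (λ x → ∑ ts (head x))
    ≡⟨ cong₂ _+_ (∑-cong box (λ x → ∑-tuples-G k (ℤ.≤-trans (m-i²≤m m x) m≤M)))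
                 (trans (∑-swap box ts head) (∑-cong ts (λ t → theta-identity (ℤ.≤-trans (m-sumSq≤m t) m≤M)))) ⟩
  ∑ box (λ x → + (2 ℕ.* k) * ∑ ts (λ t → G (m - x * x - sumSq t))) +
  ∑ ts (λ t → + 2 * ∑ box (λ x → G (m - sumSq t - x * x)))
    ≡⟨ cong₂ _+_ (∑-* box (+ (2 ℕ.* k)) _) (trans (∑-* ts (+ 2) _) (cong (+ 2 *_) (∑-swap ts box _))) ⟩
  + (2 ℕ.* k) * ∑ box (λ x → ∑ ts (λ t → G (m - x * x - sumSq t))) +
  + 2 * ∑ box (λ x → ∑ ts (λ t → G (m - sumSq t - x * x)))
    ≡⟨ cong₂ (λ a b → + (2 ℕ.* k) * a + + 2 * b)
         (∑-cong box (λ x → ∑-cong ts (λ t → cong G (diff₁ m (x * x) (sumSq t)))))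
         (∑-cong box (λ x → ∑-cong ts (λ t → cong G (diff₂ m (x * x) (sumSq t))))) ⟩
  + (2 ℕ.* k) * Z + + 2 * Z
    ≡⟨ ℤ.*-distribʳ-+ Z (+ (2 ℕ.* k)) (+ 2) ⟨
  + (2 ℕ.* k ℕ.+ 2) * Z
    ≡⟨ cong (λ c → + c * Z) (trans (ℕ.+-comm (2 ℕ.* k) 2) (sym (ℕ.*-suc 2 k))) ⟩
  + (2 ℕ.* suc k) * Z
    ≡⟨ cong (+ (2 ℕ.* suc k) *_) (∑-tuples k box _) ⟨
  + (2 ℕ.* suc k) * ∑ (tuples (suc k) box) (λ xs → G (m - sumSq xs)) ∎
  where
  open ≡-Reasoning
  box = intsUpTo M
  ts = tuples k box
  Z = ∑ box (λ x → ∑ ts (λ t → G (m - (x * x + sumSq t))))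
  tail head : ℤ → List ℤ → ℤ
  tail x t = guard (sumSq t ℤ.≟ m - x * x) (m - x * x)
  head x t = guard (x * x ℤ.≟ m - sumSq t) (m - sumSq t)
  m-sumSq≤m : ∀ t → m - sumSq t ≤ m
  m-sumSq≤m t = subst (m - sumSq t ≤_) (ℤ.+-identityʳ m) (ℤ.+-monoʳ-≤ m (ℤ.neg-mono-≤ (0≤sumSq t)))
  diff₁ : ∀ m a b → m - a - b ≡ m - (a + b)
  diff₁ = solve-∀
  diff₂ : ∀ m a b → m - b - a ≡ m - (a + b)
  diff₂ = solve-∀
  split : ∀ x t → guard (x * x + sumSq t ℤ.≟ m) m ≡ tail x t + head x t
  split x t = begin
    guard sol? m                                        ≡⟨ guard-cong sol? sol? id id value ⟩
    guard sol? (m - x * x + (m - sumSq t))              ≡⟨ guard-+ sol? _ _ ⟩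
    guard sol? (m - x * x) + guard sol? (m - sumSq t)
      ≡⟨ cong₂ _+_ (guard-cong sol? (sumSq t ℤ.≟ m - x * x) i+j≡k⇒j≡k-i j≡k-i⇒i+j≡k (λ _ → refl))
                   (guard-cong sol? (x * x ℤ.≟ m - sumSq t)
                      (λ eq → i+j≡k⇒j≡k-i {sumSq t} (trans (ℤ.+-comm (sumSq t) (x * x)) eq))
                      (λ eq → trans (ℤ.+-comm (x * x) (sumSq t)) (j≡k-i⇒i+j≡k eq)) (λ _ → refl)) ⟩
    tail x t + head x t ∎
    where
    sol? = x * x + sumSq t ℤ.≟ m
    value : x * x + sumSq t ≡ m → m ≡ m - x * x + (m - sumSq t)
    value refl = ring (x * x) (sumSq t)
      where
      ring : ∀ a b → a + b ≡ a + b - a + (a + b - b)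
      ring = solve-∀

-- Representation numbers and the size of the box

-- In `r` the box grows with the target. Separating the two allows `r k j` for all j < n to be read
-- off from the single box of size n.
count : ℕ → ℕ → ℤ → ℤ
count M k z = ∑ (tuples k (intsUpTo M)) (λ xs → guard (sumSq xs ℤ.≟ z) 1ℤ)

count-suc : ∀ M k z → count M (suc k) z ≡ ∑ (intsUpTo M) (λ x → count M k (z - x * x))
count-suc M k z = trans (∑-tuples k (intsUpTo M) _) (∑-cong (intsUpTo M) λ x → ∑-cong (tuples k (intsUpTo M)) λ t →
  guard-cong (x * x + sumSq t ℤ.≟ z) (sumSq t ℤ.≟ z - x * x) i+j≡k⇒j≡k-i j≡k-i⇒i+j≡k (λ _ → refl))

count-negative : ∀ M k {z} → z < 0ℤ → count M k z ≡ 0ℤ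
count-negative M k z<0 = ∑-zero (tuples k (intsUpTo M)) λ {t} _ →
  guard-no (sumSq t ℤ.≟ _) (λ { refl → ℤ.<⇒≱ z<0 (0≤sumSq t) }) 1ℤ

-- A coordinate of a solution satisfies |x| ≤ x² ≤ z ≤ M; any other x leaves a negative remainder,
-- which is represented by no tuple.
count-box : ∀ k {M N z} → z ≤ + M → M ℕ.≤ N → count M k z ≡ count N k z
count-box zero    _   _   = refl
count-box (suc k) {M} {N} {z} z≤M M≤N = begin
  count M (suc k) z
    ≡⟨ count-suc M k z ⟩
  ∑ (intsUpTo M) (λ x → count M k (z - x * x))
    ≡⟨ ∑-cong (intsUpTo M) (λ x → trans (count-box k (ℤ.≤-trans (m-i²≤m z x) z≤M) M≤N) (restrict x)) ⟩
  ∑ (intsUpTo M) (λ x → guard (x * x ℤ.≤? z) (count N k (z - x * x)))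
    ≡⟨ ∑-bijection ℤ._≟_ ℤ._≟_ (λ x → x * x ℤ.≤? z) (λ x → x * x ℤ.≤? z)
         (intsUpTo-unique M , λ {x} x²≤z → ∈-intsUpTo x (i²≤M⇒∣i∣≤M x (ℤ.≤-trans x²≤z z≤M)))
         (intsUpTo-unique N , λ {x} x²≤z → ∈-intsUpTo x (i²≤M⇒∣i∣≤M x (ℤ.≤-trans x²≤z (ℤ.≤-trans z≤M (+≤+ M≤N)))))
         id id id (λ _ → refl) id (λ _ → refl) (λ _ → refl) ⟩
  ∑ (intsUpTo N) (λ x → guard (x * x ℤ.≤? z) (count N k (z - x * x)))
    ≡⟨ ∑-cong (intsUpTo N) restrict ⟨
  ∑ (intsUpTo N) (λ x → count N k (z - x * x))
    ≡⟨ count-suc N k z ⟨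
  count N (suc k) z ∎
  where
  open ≡-Reasoning
  restrict : ∀ x → count N k (z - x * x) ≡ guard (x * x ℤ.≤? z) (count N k (z - x * x))
  restrict x = by-cases (x * x ℤ.≤? z)
    where
    flip : ∀ z a → a - z ≡ 0ℤ - (z - a)
    flip = solve-∀
    by-cases : (le? : Dec (x * x ≤ z)) → count N k (z - x * x) ≡ guard le? (count N k (z - x * x))
    by-cases (yes _)    = refl
    by-cases (no x²≰z) = count-negative N k (<-by-difference {z} {x * x} (flip z (x * x)) (ℤ.≰⇒> x²≰z))

r≡count : ∀ k n → + r k n ≡ count n k (+ n)
r≡count k n = ∑-filter (λ xs → sumSq xs ℤ.≟ + n) (tuples k (intsUpTo n))

-- Only the zero vector counts, as the box of size 0 contains nothing else. This makes the j = 0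
-- term of the convolution the isolated term of the recurrence.
r-zero : ∀ k → + r k 0 ≡ 1ℤ
r-zero k = trans (r≡count k 0) (go k)
  where
  go : ∀ k → count 0 k 0ℤ ≡ 1ℤ
  go zero    = refl
  go (suc k) = trans (count-suc 0 k 0ℤ) (trans (ℤ.+-identityʳ _) (go k))

-- Sorts tuples by their sum of squares s. The range j < n suffices because G vanishes at n - s when
-- s ≥ n.
G-pick : ∀ n s → 0ℤ ≤ s → G (+ n - s) ≡ ∑ (upTo n) (λ j → guard (s ℤ.≟ + j) (G (+ n - + j)))
G-pick n (+ a) _ with a ℕ.<? n
... | yes a<n = sym (trans
  (∑-cong (upTo n) (λ j → guard-cong (+ a ℤ.≟ + j) (j ℕ.≟ a)
    (sym ∘ ℤ.+-injective) (cong +_ ∘ sym) (λ { refl → refl })))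
  (∑-pick ℕ._≟_ (G (+ n - + a)) (Unique.upTo⁺ n) (∈-upTo⁺ a<n)))
... | no a≮n = trans (cong G (trans (ℤ.[+m]-[+n]≡m⊖n n a) (ℤ.⊖-≤ (ℕ.≮⇒≥ a≮n)))) (trans (G-nonPositive (a ∸ n))
  (sym (∑-zero (upTo n) λ {j} j∈ → guard-no (+ a ℤ.≟ + j) (λ { refl → a≮n (∈-upTo⁻ j∈) }) _)))
  where
  G-nonPositive : ∀ k → G (- + k) ≡ 0ℤ
  G-nonPositive zero    = refl
  G-nonPositive (suc k) = refl

∑-tuples-count : ∀ k n → ∑ (tuples k (intsUpTo n)) (λ xs → G (+ n - sumSq xs)) ≡
                         ∑ (upTo n) (λ j → + r k j * G (+ (n ∸ j)))
∑-tuples-count k n = begin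
  ∑ ts (λ xs → G (+ n - sumSq xs))
    ≡⟨ ∑-cong ts (λ xs → G-pick n (sumSq xs) (0≤sumSq xs)) ⟩
  ∑ ts (λ xs → ∑ (upTo n) (λ j → guard (sumSq xs ℤ.≟ + j) (G (+ n - + j))))
    ≡⟨ ∑-swap ts (upTo n) _ ⟩
  ∑ (upTo n) (λ j → ∑ ts (λ xs → guard (sumSq xs ℤ.≟ + j) (G (+ n - + j))))
    ≡⟨ ∑-cong-∈ (upTo n) (λ j∈ → inner (∈-upTo⁻ j∈)) ⟩
  ∑ (upTo n) (λ j → + r k j * G (+ (n ∸ j))) ∎
  where
  open ≡-Reasoning
  ts = tuples k (intsUpTo n)
  inner : ∀ {j} → j ℕ.< n → ∑ ts (λ xs → guard (sumSq xs ℤ.≟ + j) (G (+ n - + j))) ≡ + r k j * G (+ (n ∸ j))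
  inner {j} j<n = begin
    ∑ ts (λ xs → guard (sumSq xs ℤ.≟ + j) g)
      ≡⟨ ∑-cong ts (λ xs → guard-scale (sumSq xs ℤ.≟ + j) g) ⟩
    ∑ ts (λ xs → g * guard (sumSq xs ℤ.≟ + j) 1ℤ)
      ≡⟨ ∑-* ts g _ ⟩
    g * count n k (+ j)
      ≡⟨ ℤ.*-comm g _ ⟩
    count n k (+ j) * g
      -- The box of size n gives the same count as the box of size j used by `r k j`.
      ≡⟨ cong₂ _*_ (trans (sym (count-box k ℤ.≤-refl (ℕ.<⇒≤ j<n))) (sym (r≡count k j)))
                   (cong G (trans (ℤ.[+m]-[+n]≡m⊖n n j) (ℤ.⊖-≥ (ℕ.<⇒≤ j<n)))) ⟩
    + r k j * G (+ (n ∸ j)) ∎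
    where g = G (+ n - + j)

theorem2p2 : (k n : ℕ) → 1 Data.Nat.≤ n →
    (+ n) * (+ r k n)
    ≡ (+ (2 Data.Nat.* k)) * (((+ sigmaStar n) - (+ 4) * (+ sigmaStarHalf n))
    + sumRange n (λ j → (+ r k j) * ((+ sigmaStar (n ∸ j)) - (+ 4) * (+ sigmaStarHalf (n ∸ j)))))
theorem2p2 k n@(suc p) _ = begin
  + n * + r k n
    ≡⟨ cong (+ n *_) (r≡count k n) ⟩
  + n * count n k (+ n)
    ≡⟨ ∑-* ts (+ n) _ ⟨
  ∑ ts (λ xs → + n * guard (sumSq xs ℤ.≟ + n) 1ℤ)
    ≡⟨ ∑-cong ts (λ xs → guard-scale (sumSq xs ℤ.≟ + n) (+ n)) ⟨
  ∑ ts (λ xs → guard (sumSq xs ℤ.≟ + n) (+ n))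
    ≡⟨ ∑-tuples-G k ℤ.≤-refl ⟩
  + (2 ℕ.* k) * ∑ ts (λ xs → G (+ n - sumSq xs))
    ≡⟨ cong (+ (2 ℕ.* k) *_) (∑-tuples-count k n) ⟩
  -- For n = suc p the list `upTo n` computes to 0 followed by the range of `sumRange n`, so the j =
  -- 0 term splits off by definition.
  + (2 ℕ.* k) * (+ r k 0 * G (+ n) + rest)
    ≡⟨ cong (λ c → + (2 ℕ.* k) * (c * G (+ n) + rest)) (r-zero k) ⟩
  + (2 ℕ.* k) * (1ℤ * G (+ n) + rest)
    ≡⟨ cong (λ g → + (2 ℕ.* k) * (g + rest)) (ℤ.*-identityˡ (G (+ n))) ⟩
  + (2 ℕ.* k) * (G (+ n) + rest) ∎
  where
  open ≡-Reasoning
  rest = sumRange n (λ j → + r k j * G (+ (n ∸ j)))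
  ts = tuples k (intsUpTo n)
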